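{- With $C(n)$ and $C'(n)$ as defined in the context: (a) $$\sum_{n\ge1}C(n)q^n=\frac{2q^3(2-q+q^2)}{(1+q)(1+q^3)^2}\frac{(-q^2,-q^4;q^2)_\infty}{(q;q^2)_\infty^2}+\frac{q^2(1-q)}{(1+q)(1+q^3)^2}$$ $$=\frac{2q^3(2-q+q^2)}{(1+q)(1+q^3)^2}\frac{(-q^2,-q^4;q^2)_\infty}{(q;q^2)_\infty^2}+\sum_{n\ge0}(-1)^n(n+1)\big(n-nq+(n+1)q^2\big)q^{3n};$$ (b) $$\sum_{n\ge1}C'(n)q^n=\frac{q^2(1+q)}{(1-q)(1-q^3)^2}=\sum_{n\ge0}(n+1)\big(n+nq+(n+1)q^2\big)q^{3n}.$$
   Context: $(a;q)_\infty=\prod_{j\ge0}(1-aq^j)$, $(a_1,a_2;q)_\infty=(a_1;q)_\infty(a_2;q)_\infty$, $|q|<1$. A two-color partition is a partition whose parts are each colored blue or green (the same integer may occur in both colors). For a positive integer $n$, $C(n)$ is the number of two-color partitions of $n$ in which: the smallest part $s$ is odd and occurs at least once in each color, and every blue even part is at least $s+5$; no even integer occurs more than once in the same color (odd parts may repeat). $C_0(n)$ (resp. $C_1(n)$) is the number of partitions counted by $C(n)$ whose total number of even parts is even (resp. odd), and $C'(n)=C_0(n)-C_1(n)$. Equivalently, $\sum_{n\ge1}C(n)q^n=\sum_{n\ge0}q^{2(2n+1)}\frac{(-q^{2n+6};q^2)_\infty(-q^{2n+2};q^2)_\infty}{(q^{2n+1};q^2)_\infty^2}$ and $\sum_{n\ge1}C'(n)q^n=\sum_{n\ge0}q^{2(2n+1)}\frac{(q^{2n+6};q^2)_\infty(q^{2n+2};q^2)_\infty}{(q^{2n+1};q^2)_\infty^2}$.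 -}

module Defs where

open import Data.Bool.Base using (Bool; true; false; _∧_; _∨_; not; if_then_else_)
open import Data.Nat.Base as ℕ using (ℕ; zero; suc; _∸_; _≤ᵇ_; _≡ᵇ_; _⊓_)
open import Data.Integer.Base as ℤ using (ℤ; +_)
open import Data.List.Base as List
  using (List; []; _∷_; _++_; map; concatMap; cartesianProduct; upTo; filterᵇ; length; foldr; zipWith)
open import Data.Bool.ListAction using (all; any)
open import Data.Product.Base using (_×_; _,_)
open import Relation.Binary.PropositionalEquality using (_≡_)

isEven : ℕ → Bool
isEven zero          = true
isEven (suc zero)    = false
isEven (suc (suc n)) = isEven n

isOdd : ℕ → Bool
isOdd n = not (isEven n)

sumℕ : List ℕ → ℕ
sumℕ = foldr ℕ._+_ 0

nonIncreasing : List ℕ → Bool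
nonIncreasing []           = true
nonIncreasing (x ∷ [])     = true
nonIncreasing (x ∷ y ∷ xs) = (y ≤ᵇ x) ∧ nonIncreasing (y ∷ xs)

isPartitionOf : ℕ → List ℕ → Bool
isPartitionOf n xs = all (1 ≤ᵇ_) xs ∧ nonIncreasing xs ∧ (sumℕ xs ≡ᵇ n)

-- all lists of length ≤ l with entries in {0,…,n}, each listed exactly once
listsUpTo : ℕ → ℕ → List (List ℕ)
listsUpTo zero    n = [] ∷ []
listsUpTo (suc l) n = [] ∷ concatMap (λ x → map (x ∷_) (listsUpTo l n)) (upTo (suc n))

-- all partitions of n (a partition of n has at most n parts, each ≤ n)
partitionsOf : ℕ → List (List ℕ)
partitionsOf n = filterᵇ (isPartitionOf n) (listsUpTo n n)

-- a two-colour partition of n is a pair (blue parts , green parts)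
-- of ordinary partitions whose sizes add up to n
twoColourPartitionsOf : ℕ → List (List ℕ × List ℕ)
twoColourPartitionsOf n =
  concatMap (λ m → cartesianProduct (partitionsOf m) (partitionsOf (n ∸ m))) (upTo (suc n))

count : ℕ → List ℕ → ℕ
count x xs = length (filterᵇ (x ≡ᵇ_) xs)

elemᵇ : ℕ → List ℕ → Bool
elemᵇ x xs = any (x ≡ᵇ_) xs

evenPartsDistinct : List ℕ → Bool
evenPartsDistinct xs = all (λ p → not (isEven p) ∨ (count p xs ≤ᵇ 1)) xs

condC : List ℕ × List ℕ → Bool
condC ([] , _)           = false
condC (_ ∷ _ , [])       = false
condC (b ∷ bs , g ∷ gs)  =
  let blue  = b ∷ bs
      green = g ∷ gs
      s     = foldr _⊓_ b (bs ++ green)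
  in isOdd s ∧ elemᵇ s blue ∧ elemᵇ s green
     ∧ all (λ p → not (isEven p) ∨ (suc (s ℕ.+ 5) ≤ᵇ suc p)) blue
     ∧ evenPartsDistinct blue ∧ evenPartsDistinct green

numEvenParts : List ℕ × List ℕ → ℕ
numEvenParts (bs , gs) = length (filterᵇ isEven (bs ++ gs))

C : ℕ → ℕ
C n = length (filterᵇ condC (twoColourPartitionsOf n))

C₀ : ℕ → ℕ
C₀ n = length (filterᵇ (λ π → condC π ∧ isEven (numEvenParts π)) (twoColourPartitionsOf n))

C₁ : ℕ → ℕ
C₁ n = length (filterᵇ (λ π → condC π ∧ isOdd (numEvenParts π)) (twoColourPartitionsOf n))

C′ : ℕ → ℤ
C′ n = (+ C₀ n) ℤ.- (+ C₁ n)

FPS : Set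
FPS = ℕ → ℤ

_≐_ : FPS → FPS → Set
f ≐ g = ∀ n → f n ≡ g n
infix 4 _≐_

sumℤ : List ℤ → ℤ
sumℤ = foldr ℤ._+_ (+ 0)

⟨_⟩ : ℤ → FPS
⟨ c ⟩ zero    = c
⟨ c ⟩ (suc n) = + 0

q^ : ℕ → FPS
q^ k n = if n ≡ᵇ k then + 1 else + 0

infixl 6 _⊕_ _⊖_
infixl 7 _⊛_

_⊕_ : FPS → FPS → FPS
(f ⊕ g) n = f n ℤ.+ g n

_⊖_ : FPS → FPS → FPS
(f ⊖ g) n = f n ℤ.- g n

_⊛_ : FPS → FPS → FPS
(f ⊛ g) n = sumℤ (map (λ i → f i ℤ.* g (n ∸ i)) (upTo (suc n)))

prodL : List FPS → FPS
prodL = foldr _⊛_ ⟨ + 1 ⟩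

-- infinite product ∏_{j≥0} f j; the coefficient of q^n is computed from the
-- factors j ≤ n, which is correct whenever f j ≡ 1 mod q^(j+1) (all uses below)
prod∞ : (ℕ → FPS) → FPS
prod∞ f n = prodL (map f (upTo (suc n))) n

-- infinite sum ∑_{k≥0} f k; correct whenever f k ≡ 0 mod q^k (all uses below)
sum∞ : (ℕ → FPS) → FPS
sum∞ f n = sumℤ (map (λ k → f k n) (upTo (suc n)))

-- q-Pochhammer symbol (a q^c ; q^d)_∞ = ∏_{j≥0} (1 - a q^(c + d j)), for d ≥ 1
poch : ℤ → ℕ → ℕ → FPS
poch a c d = prod∞ (λ j → ⟨ + 1 ⟩ ⊖ ⟨ a ⟩ ⊛ q^ (c ℕ.+ d ℕ.* j))

-- multiplicative inverse of a series with constant term 1: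
-- g 0 = 1,  g (n+1) = - ∑_{k=1}^{n+1} f k · g (n+1-k)
private
  -- invRev f n = [g n , g (n-1) , … , g 0]
  invRev : FPS → ℕ → List ℤ
  invRev f zero    = + 1 ∷ []
  invRev f (suc n) =
    let prev = invRev f n
    in ℤ.- sumℤ (zipWith (λ i gi → f (suc i) ℤ.* gi) (upTo (suc n)) prev) ∷ prev

inv : FPS → FPS
inv f n with invRev f n
... | []    = + 0
... | g ∷ _ = g

genC : FPS
genC zero    = + 0
genC (suc n) = + C (suc n)

genC′ : FPS
genC′ zero    = + 0
genC′ (suc n) = C′ (suc n)

denA : FPS
denA = (⟨ + 1 ⟩ ⊕ q^ 1) ⊛ (⟨ + 1 ⟩ ⊕ q^ 3) ⊛ (⟨ + 1 ⟩ ⊕ q^ 3)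

termA : FPS
termA = ⟨ + 2 ⟩ ⊛ q^ 3 ⊛ (⟨ + 2 ⟩ ⊖ q^ 1 ⊕ q^ 2) ⊛ inv denA
        ⊛ (poch (ℤ.- (+ 1)) 2 2 ⊛ poch (ℤ.- (+ 1)) 4 2)
        ⊛ inv (poch (+ 1) 1 2 ⊛ poch (+ 1) 1 2)

rhsA₁ : FPS
rhsA₁ = termA ⊕ q^ 2 ⊛ (⟨ + 1 ⟩ ⊖ q^ 1) ⊛ inv denA

signℤ : ℕ → ℤ
signℤ n = if isEven n then + 1 else ℤ.- (+ 1)

seriesA : FPS
seriesA = sum∞ (λ n → ⟨ signℤ n ℤ.* + (suc n) ⟩
                       ⊛ (⟨ + n ⟩ ⊖ ⟨ + n ⟩ ⊛ q^ 1 ⊕ ⟨ + suc n ⟩ ⊛ q^ 2)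
                       ⊛ q^ (3 ℕ.* n))

rhsA₂ : FPS
rhsA₂ = termA ⊕ seriesA

rhsB₁ : FPS
rhsB₁ = q^ 2 ⊛ (⟨ + 1 ⟩ ⊕ q^ 1)
        ⊛ inv ((⟨ + 1 ⟩ ⊖ q^ 1) ⊛ (⟨ + 1 ⟩ ⊖ q^ 3) ⊛ (⟨ + 1 ⟩ ⊖ q^ 3))

rhsB₂ : FPS
rhsB₂ = sum∞ (λ n → ⟨ + suc n ⟩
                     ⊛ (⟨ + n ⟩ ⊕ ⟨ + n ⟩ ⊛ q^ 1 ⊕ ⟨ + suc n ⟩ ⊛ q^ 2)
                     ⊛ q^ (3 ℕ.* n))

{-# OPTIONS --safe #-}
module Submission where

-- Let z = 1 for C′ and z = -1 for C, so that an even part has weight -z. Splitting by the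
-- smallest part x = q^(2j+1), the series is the sum of x² P(x), where P(x) is the product of the
-- generating functions of the admissible blue and green parts, and
--   (1 - x)² P(x) = (1 - z q⁵x) (1 - z q x) P(q²x).
-- Gosper's method gives a telescoping certificate: with D = (1 - zq)(1 - zq³)²,
--   D x² P(x) = U(q²x) - U(x),
--   U(x) = (1 - z q³x) (1 - z x/q) (q²(1 + zq) + zq(1 - zq - q² - zq³) x) P(x).
-- Hence D times the series is q²(1 + zq) - U(q): the first term is the limit of U at x = 0, while
-- U(q) has the factor 1 - z and so vanishes for z = 1.
-- All identities are proved modulo q^(N+1) for arbitrary N, where only finite products occur.

open import Defs hiding (_⊛_)
import Defs
open import Algebra.Bundles using (CommutativeRing)
open import Algebra.Solver.Ring.AlmostCommutativeRing
  using (fromCommutativeRing; _-Raw-AlmostCommutative⟶_)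
import Algebra.Solver.Ring
open import Data.Bool.Base using (Bool; true; false; if_then_else_; T; _∧_; _∨_; not)
open import Data.Bool.ListAction using (all)
open import Data.Bool.Properties using (T?; T-∧; T-≡)
open import Data.Empty using (⊥-elim)
open import Data.Fin using (#_)
open import Data.Integer.Base as ℤ using (ℤ; 0ℤ; 1ℤ; -1ℤ)
import Data.Integer.Properties as ℤₚ
open import Data.Integer.Tactic.RingSolver using (solve-∀)
import Data.List.Properties as Listₚ
open import Data.List.Relation.Unary.All as All using (All)
import Data.List.Relation.Unary.All.Properties as Allₚ
open import Data.List.Relation.Unary.Any using (here; there)
open import Data.List.Membership.Propositional using (_∈_)
open import Data.List.Membership.Propositional.Properties using (∈-filter⁻; ∈-upTo⁻)
open import Data.Maybe.Base as Maybe using ()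
open import Data.Nat.Base as ℕ using (ℕ; zero; suc; _∸_; _≡ᵇ_; _≤ᵇ_; _≤_; _<_; z≤n; s≤s; _⊓_)
import Data.Nat.Properties as ℕₚ
open import Data.Product.Base using (Σ; ∃; _×_; _,_; proj₁; proj₂)
open import Data.Unit.Base using (tt)
open import Data.Vec.Base using ([]; _∷_)
open import Function.Base using (_∘_; id)
open import Function.Bundles using (Equivalence)
open import Level using (0ℓ)
import Relation.Binary.PropositionalEquality as ≡
open ≡ using (_≡_; _≢_)
import Relation.Binary.Reasoning.Setoid
open import Relation.Nullary using (yes; no)
open import Relation.Nullary.Decidable using (dec⇒maybe)

-- The ansatz behind U is U(x) = (1 - z q³x) (1 - z x/q) (a + b x) P(x). The quadratic factor is the
-- right-hand factor of the functional equation of P taken at x/q², so U(q²x) = (a + b q²x) (1 - x)²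
-- P(x), and the required relation becomes an equation between cubic polynomials in x. The constant
-- terms agree; the cubic terms agree exactly because z² = 1; the linear terms fix the ratio a : b,
-- and the quadratic terms then give D. This is why z is a `Sign` and not a free parameter. To stay
-- within power series, x is written as q y with y = q^(2j), so that x/q is simply y.

data Sign : ℤ → Set where
  plus  : Sign 1ℤ
  minus : Sign -1ℤ

-- Polynomial identities and telescoping over an arbitrary commutative ring

module Identities
  (R : CommutativeRing 0ℓ 0ℓ)
  (morphism : CommutativeRing.rawRing ℤₚ.+-*-commutativeRing -Raw-AlmostCommutative⟶ fromCommutativeRing R)
  where

  open CommutativeRing R hiding (zero)
  open _-Raw-AlmostCommutative⟶_ morphism using (0-homo; 1-homo; +-homo; *-homo) renaming (⟦_⟧ to ι)
  open Algebra.Solver.Ring _ _ morphism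
    (λ a b → Maybe.map (λ a≡b → reflexive (≡.cong ι a≡b)) (dec⇒maybe (a ℤₚ.≟ b)))
  open Relation.Binary.Reasoning.Setoid setoid

  sumTo : ℕ → (ℕ → Carrier) → Carrier
  sumTo zero    t = 0#
  sumTo (suc n) t = sumTo n t + t n

  sumTo-cong : ∀ {s t} n → (∀ j → j ℕ.< n → s j ≈ t j) → sumTo n s ≈ sumTo n t
  sumTo-cong zero    s≈t = refl
  sumTo-cong (suc n) s≈t =
    +-cong (sumTo-cong n (λ j j<n → s≈t j (ℕₚ.m<n⇒m<1+n j<n))) (s≈t n (ℕₚ.n<1+n n))

  telescope : ∀ {d} {t V : ℕ → Carrier} n → (∀ j → j ℕ.< n → d * t j ≈ V j - V (suc j)) →
              d * sumTo n t ≈ V 0 - V n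
  telescope {d} {V = V} zero    step = trans (zeroʳ d) (sym (-‿inverseʳ (V 0)))
  telescope {d} {t} {V} (suc n) step = begin
    d * (sumTo n t + t n)              ≈⟨ distribˡ d _ _ ⟩
    d * sumTo n t + d * t n            ≈⟨ +-cong (telescope n (λ j j<n → step j (ℕₚ.m<n⇒m<1+n j<n))) (step n (ℕₚ.n<1+n n)) ⟩
    (V 0 - V n) + (V n - V (suc n))    ≈⟨ solve 3 (λ a b c → (a :- b) :+ (b :- c) := a :- c) refl _ _ _ ⟩
    V 0 - V (suc n)                    ∎

  cancelUnit : ∀ {u v} a b → u * v ≈ 1# → u * a ≈ u * b → a ≈ b
  cancelUnit {u} {v} a b uv≈1 ua≈ub = begin
    a              ≈⟨ expand a ⟩
    v * (u * a)    ≈⟨ *-congˡ ua≈ub ⟩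
    v * (u * b)    ≈⟨ expand b ⟨
    b              ∎
    where
    expand : ∀ c → c ≈ v * (u * c)
    expand c = begin
      c              ≈⟨ *-identityˡ c ⟨
      1# * c         ≈⟨ *-congʳ uv≈1 ⟨
      u * v * c      ≈⟨ solve 3 (λ u v c → u :* v :* c := v :* (u :* c)) refl u v c ⟩
      v * (u * c)    ∎

  linear-expand : ∀ a b c → (ι 1ℤ - a * b) * c ≈ c - a * (b * c)
  linear-expand = solve 3 (λ a b c → (con 1ℤ :- a :* b) :* c := c :- a :* (b :* c)) refl

  -- `v` is 1/(1 - b), the series of a part that may repeat: either the part is absent, or one copy
  -- is split off and further copies may remain. This becomes the recurrence by largest part when
  -- that part is odd.
  unit-expand : ∀ {b v} c → (ι 1ℤ - ι 1ℤ * b) * v ≈ ι 1ℤ → v * c ≈ c + b * (v * c)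
  unit-expand {b} {v} c uv≈1 = begin
    v * c
      ≈⟨ solve 3 (λ b v c → v :* c := (con 1ℤ :- con 1ℤ :* b) :* v :* c :+ b :* (v :* c)) refl b v c ⟩
    (ι 1ℤ - ι 1ℤ * b) * v * c + b * (v * c)
      ≈⟨ +-congʳ (*-congʳ uv≈1) ⟩
    ι 1ℤ * c + b * (v * c)
      ≈⟨ solve 2 (λ c d → con 1ℤ :* c :+ d := c :+ d) refl c _ ⟩
    c + b * (v * c) ∎

  exchange : ∀ a b c → a * (b * c) ≈ b * (a * c)
  exchange = solve 3 (λ a b c → a :* (b :* c) := b :* (a :* c)) refl

  cancel-pair : ∀ o e v c → o * v ≈ ι 1ℤ → o * (e * (v * c)) ≈ e * c
  cancel-pair o e v c ov≈1 = begin
    o * (e * (v * c))      ≈⟨ solve 4 (λ o e v c → o :* (e :* (v :* c)) := o :* v :* (e :* c)) refl o e v c ⟩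
    o * v * (e * c)        ≈⟨ *-congʳ ov≈1 ⟩
    ι 1ℤ * (e * c)         ≈⟨ solve 1 (λ a → con 1ℤ :* a := a) refl _ ⟩
    e * c                  ∎

  unit-pair : ∀ {o v} → o * v ≈ ι 1ℤ → ι 1ℤ * o * (v * ι 1ℤ) ≈ ι 1ℤ
  unit-pair {o} {v} ov≈1 =
    trans (solve 2 (λ o v → con 1ℤ :* o :* (v :* con 1ℤ) := o :* v) refl o v) ov≈1

  extend-product : ∀ {a o F e F′ b} → o * F ≈ e * F′ → a * F′ ≈ b → a * o * F ≈ b * e
  extend-product {a} {o} {F} {e} {F′} {b} oF≈eF′ aF′≈b = begin
    a * o * F        ≈⟨ *-assoc a o F ⟩
    a * (o * F)      ≈⟨ *-congˡ oF≈eF′ ⟩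
    a * (e * F′)     ≈⟨ solve 3 (λ a e F → a :* (e :* F) := a :* F :* e) refl a e F′ ⟩
    a * F′ * e       ≈⟨ *-congʳ aF′≈b ⟩
    b * e            ∎

  private variable
    n : ℕ

  -- This and the following expressions are solver polynomials, so that one definition serves both
  -- as an element of the ring and as an input to normalisation, where z may be a variable or one of
  -- the constants 1 and -1.
  denominatorₚ : (z q : Polynomial n) → Polynomial n
  denominatorₚ z q =
    (con 1ℤ :- z :* q) :* (con 1ℤ :- z :* (q :* q :* q)) :* (con 1ℤ :- z :* (q :* q :* q))

  numeratorₚ : (z q : Polynomial n) → Polynomial n
  numeratorₚ z q = q :* q :* (con 1ℤ :+ z :* q)

  slopeₚ : (z q : Polynomial n) → Polynomial n
  slopeₚ z q = z :* q :* (con 1ℤ :- z :* q :- q :* q :- z :* (q :* q :* q))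

  -- U(x) with x = q y and P = P(x).
  certificateₚ : (z q y P : Polynomial n) → Polynomial n
  certificateₚ z q y P =
    (con 1ℤ :- z :* (q :* q :* q :* q :* y)) :* (con 1ℤ :- z :* y) :*
    (numeratorₚ z q :+ slopeₚ z q :* (q :* y)) :* P

  termₚ : (z q ν y : Polynomial n) → Polynomial n
  termₚ z q ν y = (ν :+ con 1ℤ) :* (ν :+ z :* (ν :* q) :+ (ν :+ con 1ℤ) :* (q :* q)) :* y

  -- The denominator times the sum of the terms of the expansion from index ν on.
  remainderₚ : (z q ν y : Polynomial n) → Polynomial n
  remainderₚ z q ν y =
    (u :* u :* (ν :* ν) :+ u :* (con 1ℤ :+ q :* q) :* ν :+ numeratorₚ z q) :* y
    where u = con 1ℤ :- z :* (q :* q :* q)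

  module _ (q : Carrier) (z : ℤ) where
    denominator numerator : Carrier
    denominator = ⟦ denominatorₚ (var (# 0)) (var (# 1)) ⟧ (ι z ∷ q ∷ [])
    numerator   = ⟦ numeratorₚ   (var (# 0)) (var (# 1)) ⟧ (ι z ∷ q ∷ [])

    certificate : (y P : Carrier) → Carrier
    certificate y P = ⟦ certificateₚ (var (# 0)) (var (# 1)) (var (# 2)) (var (# 3)) ⟧ (ι z ∷ q ∷ y ∷ P ∷ [])

    term remainder : (ν y : Carrier) → Carrier
    term      ν y = ⟦ termₚ      (var (# 0)) (var (# 1)) (var (# 2)) (var (# 3)) ⟧ (ι z ∷ q ∷ ν ∷ y ∷ [])
    remainder ν y = ⟦ remainderₚ (var (# 0)) (var (# 1)) (var (# 2)) (var (# 3)) ⟧ (ι z ∷ q ∷ ν ∷ y ∷ [])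

  private
    ratioˡₚ : (q y P : Polynomial n) → Polynomial n
    ratioˡₚ q y P = (con 1ℤ :- q :* y) :* (con 1ℤ :- q :* y) :* P

    ratioʳₚ : (z q y P : Polynomial n) → Polynomial n
    ratioʳₚ z q y P =
      (con 1ℤ :- z :* (q :* q :* q :* q :* q :* q :* y)) :* (con 1ℤ :- z :* (q :* q :* y)) :* P

    -- The linear factor of U taken at q²x, times a slot X that receives either side of the
    -- functional equation: with the right side the result is U(q²x), with the left side it is a
    -- multiple of P(x).
    shiftedₚ : (z q y X : Polynomial n) → Polynomial n
    shiftedₚ z q y X = (numeratorₚ z q :+ slopeₚ z q :* (q :* (q :* q :* y))) :* X

  certificate-step : ∀ {z} → Sign z → ∀ q y P P′ →
    (ι 1ℤ - q * y) * (ι 1ℤ - q * y) * P ≈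
      (ι 1ℤ - ι z * (q * q * q * q * q * q * y)) * (ι 1ℤ - ι z * (q * q * y)) * P′ →
    denominator q z * (q * y * (q * y) * P) ≈
      certificate q z (q * q * y) P′ - certificate q z y P
  certificate-step {z} sign q y P P′ ratio = begin
    denominator q z * (q * y * (q * y) * P)
      ≈⟨ identity sign ⟩
    shifted ((ι 1ℤ - q * y) * (ι 1ℤ - q * y) * P) - certificate q z y P
      ≈⟨ +-congʳ (*-congˡ ratio) ⟩
    shifted ((ι 1ℤ - ι z * (q * q * q * q * q * q * y)) * (ι 1ℤ - ι z * (q * q * y)) * P′) - certificate q z y P
      ≈⟨ +-congʳ (solve 4 (λ z q y P′ → shiftedₚ z q y (ratioʳₚ z q y P′) := certificateₚ z q (q :* q :* y) P′)
                          refl (ι z) q y P′) ⟩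
    certificate q z (q * q * y) P′ - certificate q z y P ∎
    where
    shifted : Carrier → Carrier
    shifted X = ⟦ shiftedₚ (var (# 0)) (var (# 1)) (var (# 2)) (var (# 3)) ⟧ (ι z ∷ q ∷ y ∷ X ∷ [])

    -- For a variable z the two sides differ by a nonzero multiple of z² - 1, so z is replaced by a
    -- constant before normalising.
    identity : ∀ {z} → Sign z →
      denominator q z * (q * y * (q * y) * P) ≈
        ⟦ shiftedₚ (con z) (var (# 0)) (var (# 1)) (ratioˡₚ (var (# 0)) (var (# 1)) (var (# 2))) ⟧ (q ∷ y ∷ P ∷ []) -
        certificate q z y P
    identity plus  =
      solve 3 (λ q y P → denominatorₚ (con 1ℤ) q :* (q :* y :* (q :* y) :* P) :=
                         shiftedₚ (con 1ℤ) q y (ratioˡₚ q y P) :- certificateₚ (con 1ℤ) q y P) refl q y P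
    identity minus =
      solve 3 (λ q y P → denominatorₚ (con -1ℤ) q :* (q :* y :* (q :* y) :* P) :=
                         shiftedₚ (con -1ℤ) q y (ratioˡₚ q y P) :- certificateₚ (con -1ℤ) q y P) refl q y P

  certificate-cong : ∀ q z {y y′ P P′} → y ≈ y′ → P ≈ P′ → certificate q z y P ≈ certificate q z y′ P′
  certificate-cong q z y≈ P≈ =
    *-cong (*-cong (*-cong (+-congˡ (-‿cong (*-congˡ (*-congˡ y≈)))) (+-congˡ (-‿cong (*-congˡ y≈))))
                   (+-congˡ (*-congˡ (*-congˡ y≈)))) P≈

  certificate-limit : ∀ q z → certificate q z (ι 0ℤ) (ι 1ℤ) ≈ numerator q z
  certificate-limit q z =
    solve 2 (λ z q → certificateₚ z q (con 0ℤ) (con 1ℤ) := numeratorₚ z q) refl (ι z) q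

  certificate-start-plus : ∀ q P → certificate q 1ℤ (ι 1ℤ) P ≈ ι 0ℤ
  certificate-start-plus q P =
    solve 2 (λ q P → certificateₚ (con 1ℤ) q (con 1ℤ) P := con 0ℤ) refl q P

  -- The leading 2 is 1 - z, and -q³(2 - q + q²) is the value of the linear factor at x = q. The
  -- factor 1 - z q³x = 1 + q⁴ is kept next to P: for s = 1 the blue even parts begin at 6, and this
  -- factor extends their product down to 4.
  certificate-start-minus : ∀ q P → - certificate q -1ℤ (ι 1ℤ) P ≈
    ι (ℤ.+ 2) * (q * q * q) * (ι (ℤ.+ 2) - q + q * q) * ((ι 1ℤ - ι -1ℤ * (q * q * q * q)) * P)
  certificate-start-minus q P =
    solve 2 (λ q P → :- certificateₚ (con -1ℤ) q (con 1ℤ) P :=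
      con (ℤ.+ 2) :* (q :* q :* q) :* (con (ℤ.+ 2) :- q :+ q :* q) :*
      ((con 1ℤ :- con -1ℤ :* (q :* q :* q :* q)) :* P)) refl q P

  -- Since z² = 1, (1 - zq)(1 + zq + q²) = 1 - zq³. The rational function is therefore q²(1 + zq)(1
  -- + zq + q²)/(1 - zq³)³, whose coefficients are quadratic in the index up to sign. So is each
  -- tail of the expansion after multiplication by the denominator, which makes the expansion
  -- telescope.
  remainder-step : ∀ {z} → Sign z → ∀ q ν y →
    denominator q z * term q z ν y ≈ remainder q z ν y - remainder q z (ν + ι 1ℤ) (ι z * (q * q * q) * y)
  remainder-step plus  q ν y =
    solve 3 (λ q ν y → denominatorₚ (con 1ℤ) q :* termₚ (con 1ℤ) q ν y :=
                       remainderₚ (con 1ℤ) q ν y :- remainderₚ (con 1ℤ) q (ν :+ con 1ℤ) (con 1ℤ :* (q :* q :* q) :* y))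
            refl q ν y
  remainder-step minus q ν y =
    solve 3 (λ q ν y → denominatorₚ (con -1ℤ) q :* termₚ (con -1ℤ) q ν y :=
                       remainderₚ (con -1ℤ) q ν y :- remainderₚ (con -1ℤ) q (ν :+ con 1ℤ) (con -1ℤ :* (q :* q :* q) :* y))
            refl q ν y

  remainder-start : ∀ q z → remainder q z (ι 0ℤ) (ι 1ℤ) ≈ numerator q z
  remainder-start q z =
    solve 2 (λ z q → remainderₚ z q (con 0ℤ) (con 1ℤ) := numeratorₚ z q) refl (ι z) q

  remainder-vanish : ∀ q z ν {y} → y ≈ 0# → remainder q z ν y ≈ 0#
  remainder-vanish q z ν y≈0 = trans (*-congˡ y≈0) (zeroʳ _)

  -- With b = q^s for an odd s, `p` allows the part s and `w` forbids it, so p - w counts the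
  -- partitions that contain s. Deleting one copy leaves an arbitrary partition counted by p,
  -- because s may repeat.
  split-difference : ∀ {b v p w} → (ι 1ℤ - ι 1ℤ * b) * v ≈ ι 1ℤ → p ≈ v * w → p - w ≈ b * p
  split-difference {b} {v} {p} {w} uv≈1 p≈vw = begin
    p - w                      ≈⟨ +-congʳ (trans p≈vw (unit-expand w uv≈1)) ⟩
    w + b * (v * w) - w        ≈⟨ solve 2 (λ w c → w :+ c :- w := c) refl w _ ⟩
    b * (v * w)                ≈⟨ *-congˡ p≈vw ⟨
    b * p                      ∎

  -- `p n` stands for `q^ n`, which is given by its coefficients and not by repeated multiplication.
  -- The two laws are what makes it a power of q in the ring.
  module Powers (p : ℕ → Carrier) (p-0 : p 0 ≈ ι 1ℤ) (p-+ : ∀ m n → p (m ℕ.+ n) ≈ p m * p n) where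

    q : Carrier
    q = p 1

    p-suc : ∀ {n a} → p n ≈ a → p (suc n) ≈ a * q
    p-suc {n} {a} pn≈a = trans (p-+ 1 n) (trans (*-congˡ pn≈a) (*-comm q a))

    p-2 : p 2 ≈ q * q
    p-2 = p-suc refl
    p-3 : p 3 ≈ q * q * q
    p-3 = p-suc p-2
    p-4 : p 4 ≈ q * q * q * q
    p-4 = p-suc p-3
    p-6 : p 6 ≈ q * q * q * q * q * q
    p-6 = p-suc (p-suc p-4)

    1+2* : ∀ j → p (1 ℕ.+ 2 ℕ.* j) ≈ q * p (2 ℕ.* j)
    1+2* j = p-+ 1 (2 ℕ.* j)

    2*suc : ∀ j → p (2 ℕ.* suc j) ≈ q * q * p (2 ℕ.* j)
    2*suc j = trans (reflexive (≡.cong p (ℕₚ.*-suc 2 j))) (trans (p-+ 2 (2 ℕ.* j)) (*-congʳ p-2))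

    -- In each colour the step from least part 2j + 1 to 2j + 3 loses one odd part, whose series `v`
    -- is cancelled by one factor 1 - x, and one even part. The latter is 2 + 2j in green and 6 + 2j
    -- in blue, since the blue bound s + 5 is itself even for s = 2j + 1.
    ratio : ∀ z j {v b b′ g g′} → (ι 1ℤ - ι 1ℤ * p (1 ℕ.+ 2 ℕ.* j)) * v ≈ ι 1ℤ →
      b ≈ v * ((ι 1ℤ - ι z * p (6 ℕ.+ 2 ℕ.* j)) * b′) →
      g ≈ v * ((ι 1ℤ - ι z * p (2 ℕ.+ 2 ℕ.* j)) * g′) →
      let y = p (2 ℕ.* j) in
      (ι 1ℤ - q * y) * (ι 1ℤ - q * y) * (b * g) ≈
      (ι 1ℤ - ι z * (q * q * q * q * q * q * y)) * (ι 1ℤ - ι z * (q * q * y)) * (b′ * g′)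
    ratio z j {v} {b} {b′} {g} {g′} uv≈1 b≈ g≈ = begin
      (ι 1ℤ - q * y) * (ι 1ℤ - q * y) * (b * g)
        ≈⟨ *-cong (*-cong u≈ u≈) (*-cong b≈ g≈) ⟩
      u * u * (v * (l₆ * b′) * (v * (l₂ * g′)))
        ≈⟨ solve 6 (λ u v l₆ l₂ b g → u :* u :* (v :* (l₆ :* b) :* (v :* (l₂ :* g))) :=
                                     u :* v :* (u :* v) :* (l₆ :* l₂ :* (b :* g))) refl u v l₆ l₂ b′ g′ ⟩
      u * v * (u * v) * (l₆ * l₂ * (b′ * g′))
        ≈⟨ *-congʳ (*-cong uv≈1 uv≈1) ⟩
      ι 1ℤ * ι 1ℤ * (l₆ * l₂ * (b′ * g′))
        ≈⟨ solve 1 (λ a → con 1ℤ :* con 1ℤ :* a := a) refl _ ⟩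
      l₆ * l₂ * (b′ * g′)
        ≈⟨ *-congʳ (*-cong (+-congˡ (-‿cong (*-congˡ (trans (p-+ 6 (2 ℕ.* j)) (*-congʳ p-6)))))
                           (+-congˡ (-‿cong (*-congˡ (trans (p-+ 2 (2 ℕ.* j)) (*-congʳ p-2)))))) ⟩
      (ι 1ℤ - ι z * (q * q * q * q * q * q * y)) * (ι 1ℤ - ι z * (q * q * y)) * (b′ * g′) ∎
      where
      y  = p (2 ℕ.* j)
      u  = ι 1ℤ - ι 1ℤ * p (1 ℕ.+ 2 ℕ.* j)
      l₆ = ι 1ℤ - ι z * p (6 ℕ.+ 2 ℕ.* j)
      l₂ = ι 1ℤ - ι z * p (2 ℕ.+ 2 ℕ.* j)
      u≈ : ι 1ℤ - q * y ≈ u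
      u≈ = +-congˡ (-‿cong (trans (sym (1+2* j)) (solve 1 (λ a → a := con 1ℤ :* a) refl _)))

    -- `b j` and `g j` are the blue and green series for least part 2j + 1. In a truncated ring the
    -- limit of U at x = 0 is attained at a finite index: once q^(2J) vanishes and both series have
    -- become 1, the last certificate is its value at y = 0 and P = 1.
    sum-certificate : ∀ {z} → Sign z → ∀ J (v b g : ℕ → Carrier) →
      (∀ j → j ℕ.< J → (ι 1ℤ - ι 1ℤ * p (1 ℕ.+ 2 ℕ.* j)) * v j ≈ ι 1ℤ) →
      (∀ j → j ℕ.< J → b j ≈ v j * ((ι 1ℤ - ι z * p (6 ℕ.+ 2 ℕ.* j)) * b (suc j))) →
      (∀ j → j ℕ.< J → g j ≈ v j * ((ι 1ℤ - ι z * p (2 ℕ.+ 2 ℕ.* j)) * g (suc j))) →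
      p (2 ℕ.* J) ≈ ι 0ℤ → b J ≈ ι 1ℤ → g J ≈ ι 1ℤ →
      denominator q z * sumTo J (λ j → p (1 ℕ.+ 2 ℕ.* j) * b j * (p (1 ℕ.+ 2 ℕ.* j) * g j)) ≈
      - certificate q z (ι 1ℤ) (b 0 * g 0) + numerator q z
    sum-certificate {z} sign J v b g unit b-step g-step y≈0 b≈1 g≈1 = begin
      denominator q z * sumTo J t
        ≈⟨ telescope J step ⟩
      - cert 0 - - cert J
        ≈⟨ solve 2 (λ a b → :- a :- (:- b) := :- a :+ b) refl _ _ ⟩
      - cert 0 + cert J
        ≈⟨ +-cong (-‿cong (certificate-cong q z p-0 refl))
                  (trans (certificate-cong q z y≈0
                            (trans (*-cong b≈1 g≈1) (solve 0 (con 1ℤ :* con 1ℤ := con 1ℤ) refl)))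
                         (certificate-limit q z)) ⟩
      - certificate q z (ι 1ℤ) (b 0 * g 0) + numerator q z ∎
      where
      t : ℕ → Carrier
      t j = p (1 ℕ.+ 2 ℕ.* j) * b j * (p (1 ℕ.+ 2 ℕ.* j) * g j)
      cert : ℕ → Carrier
      cert j = certificate q z (p (2 ℕ.* j)) (b j * g j)
      step : ∀ j → j ℕ.< J → denominator q z * t j ≈ - cert j - - cert (suc j)
      step j j<J = begin
        denominator q z * t j
          ≈⟨ *-congˡ (trans (solve 3 (λ x b g → x :* b :* (x :* g) := x :* x :* (b :* g)) refl _ _ _)
                            (*-congʳ (*-cong (1+2* j) (1+2* j)))) ⟩
        denominator q z * (q * p (2 ℕ.* j) * (q * p (2 ℕ.* j)) * (b j * g j))
          ≈⟨ certificate-step sign q (p (2 ℕ.* j)) (b j * g j) (b (suc j) * g (suc j))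
               (ratio z j (unit j j<J) (b-step j j<J) (g-step j j<J)) ⟩
        certificate q z (q * q * p (2 ℕ.* j)) (b (suc j) * g (suc j)) - cert j
          ≈⟨ +-congʳ (certificate-cong q z (sym (2*suc j)) refl) ⟩
        cert (suc j) - cert j
          ≈⟨ solve 2 (λ a b → b :- a := :- a :- (:- b)) refl _ _ ⟩
        - cert j - - cert (suc j) ∎

    sum-remainder : ∀ {z} → Sign z → ∀ J (y : ℕ → Carrier) → y 0 ≈ ι 1ℤ →
      (∀ j → y (suc j) ≈ ι z * p 3 * y j) → y J ≈ 0# →
      denominator q z * sumTo J (λ j → term q z (ι (ℤ.+ j)) (y j)) ≈ numerator q z
    sum-remainder {z} sign J y y-0 y-suc y≈0 = begin
      denominator q z * sumTo J (λ j → term q z (ι (ℤ.+ j)) (y j))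
        ≈⟨ telescope J (λ j _ → trans (remainder-step sign q (ι (ℤ.+ j)) (y j)) (+-congˡ (-‿cong (next j)))) ⟩
      rem 0 - rem J
        ≈⟨ +-cong (*-congˡ y-0) (-‿cong (remainder-vanish q z (ι (ℤ.+ J)) y≈0)) ⟩
      remainder q z (ι 0ℤ) (ι 1ℤ) - 0#
        ≈⟨ +-cong (remainder-start q z) (-‿cong (sym 0-homo)) ⟩
      numerator q z - ι 0ℤ
        ≈⟨ solve 1 (λ a → a :- con 0ℤ := a) refl _ ⟩
      numerator q z ∎
      where
      rem : ℕ → Carrier
      rem j = remainder q z (ι (ℤ.+ j)) (y j)
      next : ∀ j → remainder q z (ι (ℤ.+ j) + ι 1ℤ) (ι z * (q * q * q) * y j) ≈ rem (suc j)
      next j = *-cong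
        (+-cong (+-cong (*-congˡ (*-cong ν≈ ν≈)) (*-congˡ ν≈)) refl)
        (sym (trans (y-suc j) (*-congʳ (*-congˡ p-3))))
        where
        ν≈ : ι (ℤ.+ j) + ι 1ℤ ≈ ι (ℤ.+ suc j)
        ν≈ = trans (sym (+-homo (ℤ.+ j) 1ℤ)) (reflexive (≡.cong (λ n → ι (ℤ.+ n)) (ℕₚ.+-comm j 1)))

    quotient : ∀ {d i s c} → d * i ≈ ι 1ℤ → d * s ≈ c → s ≈ c * i
    quotient {d} {i} {s} {c} di≈1 ds≈c = cancelUnit s (c * i) (trans di≈1 1-homo) (begin
      d * s          ≈⟨ ds≈c ⟩
      c              ≈⟨ solve 1 (λ c → c := c :* con 1ℤ) refl c ⟩
      c * ι 1ℤ       ≈⟨ *-congˡ di≈1 ⟨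
      c * (d * i)    ≈⟨ solve 3 (λ c d i → c :* (d :* i) := d :* (c :* i)) refl c d i ⟩
      d * (c * i)    ∎)

    denominator-plus : (ι 1ℤ - p 1) * (ι 1ℤ - p 3) * (ι 1ℤ - p 3) ≈ denominator q 1ℤ
    denominator-plus = trans
      (*-cong (*-congˡ (+-congˡ (-‿cong p-3))) (+-congˡ (-‿cong p-3)))
      (solve 1 (λ q → (con 1ℤ :- q) :* (con 1ℤ :- q :* q :* q) :* (con 1ℤ :- q :* q :* q) :=
                      denominatorₚ (con 1ℤ) q) refl q)

    denominator-minus : (ι 1ℤ + p 1) * (ι 1ℤ + p 3) * (ι 1ℤ + p 3) ≈ denominator q -1ℤ
    denominator-minus = trans
      (*-cong (*-congˡ (+-congˡ p-3)) (+-congˡ p-3))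
      (solve 1 (λ q → (con 1ℤ :+ q) :* (con 1ℤ :+ q :* q :* q) :* (con 1ℤ :+ q :* q :* q) :=
                      denominatorₚ (con -1ℤ) q) refl q)

    numerator-plus : p 2 * (ι 1ℤ + p 1) ≈ numerator q 1ℤ
    numerator-plus = trans (*-congʳ p-2)
      (solve 1 (λ q → q :* q :* (con 1ℤ :+ q) := numeratorₚ (con 1ℤ) q) refl q)

    numerator-minus : p 2 * (ι 1ℤ - p 1) ≈ numerator q -1ℤ
    numerator-minus = trans (*-congʳ p-2)
      (solve 1 (λ q → q :* q :* (con 1ℤ :- q) := numeratorₚ (con -1ℤ) q) refl q)

    -- Here `o` is (q;q²)_∞ and `w` the inverse of its square, `b` and `g` are the blue and green
    -- series for s = 1, `l` is 1 + q⁴, and `e₂`, `e₄` are the products over even exponents from 2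
    -- and from 4.
    product-start : ∀ {o w l b g e₂ e₄} → o * o * w ≈ ι 1ℤ → o * (l * b) ≈ e₄ → o * g ≈ e₂ →
                    l * (b * g) ≈ e₂ * e₄ * w
    product-start {o} {w} {l} {b} {g} {e₂} {e₄} ow≈1 b≈ g≈ = quotient ow≈1 (begin
      o * o * (l * (b * g))      ≈⟨ solve 4 (λ o l b g → o :* o :* (l :* (b :* g)) := o :* g :* (o :* (l :* b))) refl o l b g ⟩
      o * g * (o * (l * b))      ≈⟨ *-cong g≈ b≈ ⟩
      e₂ * e₄                    ∎)

    value-plus : ∀ {i s P} → (ι 1ℤ - p 1) * (ι 1ℤ - p 3) * (ι 1ℤ - p 3) * i ≈ ι 1ℤ →
      denominator q 1ℤ * s ≈ - certificate q 1ℤ (ι 1ℤ) P + numerator q 1ℤ →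
      s ≈ p 2 * (ι 1ℤ + p 1) * i
    value-plus {i} {s} {P} di≈1 ds≈ = quotient di≈1 (begin
      (ι 1ℤ - p 1) * (ι 1ℤ - p 3) * (ι 1ℤ - p 3) * s       ≈⟨ *-congʳ denominator-plus ⟩
      denominator q 1ℤ * s                                  ≈⟨ ds≈ ⟩
      - certificate q 1ℤ (ι 1ℤ) P + numerator q 1ℤ          ≈⟨ +-congʳ (-‿cong (certificate-start-plus q P)) ⟩
      - ι 0ℤ + numerator q 1ℤ                               ≈⟨ solve 1 (λ a → :- con 0ℤ :+ a := a) refl _ ⟩
      numerator q 1ℤ                                        ≈⟨ numerator-plus ⟨
      p 2 * (ι 1ℤ + p 1)                                    ∎)

    value-minus : ∀ {i s P E w} → (ι 1ℤ + p 1) * (ι 1ℤ + p 3) * (ι 1ℤ + p 3) * i ≈ ι 1ℤ →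
      denominator q -1ℤ * s ≈ - certificate q -1ℤ (ι 1ℤ) P + numerator q -1ℤ →
      (ι 1ℤ - ι -1ℤ * p 4) * P ≈ E * w →
      s ≈ ι (ℤ.+ 2) * p 3 * (ι (ℤ.+ 2) - p 1 + p 2) * i * E * w + p 2 * (ι 1ℤ - p 1) * i
    value-minus {i} {s} {P} {E} {w} di≈1 ds≈ start = begin
      s
        ≈⟨ quotient di≈1 (trans (*-congʳ denominator-minus) ds≈) ⟩
      (- certificate q -1ℤ (ι 1ℤ) P + numerator q -1ℤ) * i
        ≈⟨ *-congʳ (+-cong (certificate-start-minus q P) (sym numerator-minus)) ⟩
      (ι (ℤ.+ 2) * (q * q * q) * (ι (ℤ.+ 2) - q + q * q) * ((ι 1ℤ - ι -1ℤ * (q * q * q * q)) * P) +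
       p 2 * (ι 1ℤ - p 1)) * i
        ≈⟨ *-congʳ (+-congʳ (*-cong (*-cong (*-congˡ (sym p-3)) (+-congˡ (sym p-2)))
             (trans (*-congʳ (+-congˡ (-‿cong (*-congˡ (sym p-4))))) start))) ⟩
      (ι (ℤ.+ 2) * p 3 * (ι (ℤ.+ 2) - p 1 + p 2) * (E * w) + p 2 * (ι 1ℤ - p 1)) * i
        ≈⟨ solve 5 (λ a E w b i → (a :* (E :* w) :+ b) :* i := a :* i :* E :* w :+ b :* i) refl _ E w _ i ⟩
      ι (ℤ.+ 2) * p 3 * (ι (ℤ.+ 2) - p 1 + p 2) * i * E * w + p 2 * (ι 1ℤ - p 1) * i ∎

    3*suc : ∀ j → p (3 ℕ.* suc j) ≈ p 3 * p (3 ℕ.* j)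
    3*suc j = trans (reflexive (≡.cong p (ℕₚ.*-suc 3 j))) (p-+ 3 (3 ℕ.* j))

    ι-suc : ∀ j → ι (ℤ.+ suc j) ≈ ι (ℤ.+ j) + ι 1ℤ
    ι-suc j = trans (reflexive (≡.cong (λ n → ι (ℤ.+ n)) (ℕₚ.+-comm 1 j))) (+-homo (ℤ.+ j) 1ℤ)

    series-plus : ∀ {i} J → (ι 1ℤ - p 1) * (ι 1ℤ - p 3) * (ι 1ℤ - p 3) * i ≈ ι 1ℤ → p (3 ℕ.* J) ≈ 0# →
      p 2 * (ι 1ℤ + p 1) * i ≈
      sumTo J (λ j → ι (ℤ.+ suc j) * (ι (ℤ.+ j) + ι (ℤ.+ j) * p 1 + ι (ℤ.+ suc j) * p 2) * p (3 ℕ.* j))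
    series-plus {i} J di≈1 vanish = sym (quotient di≈1 (begin
      _ ≈⟨ *-cong denominator-plus (sumTo-cong J λ j _ → term-plus j) ⟩
      _ ≈⟨ sum-remainder plus J (λ j → p (3 ℕ.* j)) p-0
             (λ j → trans (3*suc j) (solve 2 (λ a b → a :* b := con 1ℤ :* a :* b) refl _ _)) vanish ⟩
      numerator q 1ℤ ≈⟨ numerator-plus ⟨
      p 2 * (ι 1ℤ + p 1) ∎))
      where
      term-plus : ∀ j →
        ι (ℤ.+ suc j) * (ι (ℤ.+ j) + ι (ℤ.+ j) * p 1 + ι (ℤ.+ suc j) * p 2) * p (3 ℕ.* j) ≈
        term q 1ℤ (ι (ℤ.+ j)) (p (3 ℕ.* j))
      term-plus j = trans
        (*-congʳ (*-cong (ι-suc j) (+-congˡ (*-cong (ι-suc j) p-2))))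
        (solve 3 (λ q ν y → (ν :+ con 1ℤ) :* (ν :+ ν :* q :+ (ν :+ con 1ℤ) :* (q :* q)) :* y :=
                            termₚ (con 1ℤ) q ν y) refl q _ _)

    series-minus : ∀ {i} J (σ : ℕ → ℤ) → σ 0 ≡ 1ℤ → (∀ j → σ (suc j) ≡ -1ℤ ℤ.* σ j) →
      (ι 1ℤ + p 1) * (ι 1ℤ + p 3) * (ι 1ℤ + p 3) * i ≈ ι 1ℤ → p (3 ℕ.* J) ≈ 0# →
      p 2 * (ι 1ℤ - p 1) * i ≈
      sumTo J (λ j → ι (σ j ℤ.* ℤ.+ suc j) * (ι (ℤ.+ j) - ι (ℤ.+ j) * p 1 + ι (ℤ.+ suc j) * p 2) * p (3 ℕ.* j))
    series-minus {i} J σ σ-0 σ-suc di≈1 vanish = sym (quotient di≈1 (begin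
      _ ≈⟨ *-cong denominator-minus (sumTo-cong J λ j _ → term-minus j) ⟩
      _ ≈⟨ sum-remainder minus J y
             (trans (*-cong (reflexive (≡.cong ι σ-0)) p-0) (solve 0 (con 1ℤ :* con 1ℤ := con 1ℤ) refl))
             (λ j → trans (*-cong (trans (reflexive (≡.cong ι (σ-suc j))) (*-homo -1ℤ (σ j))) (3*suc j))
                          (solve 4 (λ z a b c → z :* a :* (b :* c) := z :* b :* (a :* c)) refl _ _ _ _))
             (trans (*-congˡ vanish) (zeroʳ _)) ⟩
      numerator q -1ℤ ≈⟨ numerator-minus ⟨
      p 2 * (ι 1ℤ - p 1) ∎))
      where
      y : ℕ → Carrier
      y j = ι (σ j) * p (3 ℕ.* j)
      term-minus : ∀ j →
        ι (σ j ℤ.* ℤ.+ suc j) * (ι (ℤ.+ j) - ι (ℤ.+ j) * p 1 + ι (ℤ.+ suc j) * p 2) * p (3 ℕ.* j) ≈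
        term q -1ℤ (ι (ℤ.+ j)) (y j)
      term-minus j = trans
        (*-congʳ (*-cong (trans (*-homo (σ j) (ℤ.+ suc j)) (*-congˡ (ι-suc j))) (+-congˡ (*-cong (ι-suc j) p-2))))
        (solve 4 (λ q ν s y → s :* (ν :+ con 1ℤ) :* (ν :- ν :* q :+ (ν :+ con 1ℤ) :* (q :* q)) :* y :=
                              termₚ (con -1ℤ) q ν (s :* y)) refl q _ _ _)

open import Data.Integer.Base using (-_; _+_; _*_) renaming (+_ to pos)
open import Data.List.Base
  using (List; []; _∷_; _++_; map; concatMap; cartesianProduct; upTo; applyUpTo; filterᵇ; length;
         foldr; zipWith)
open import Data.List.Relation.Unary.All using ([]; _∷_)
open import Relation.Binary.PropositionalEquality hiding (J; setoid)

-- Finite sums of integers over lists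

private variable
  A B : Set

∑ : List A → (A → ℤ) → ℤ
∑ xs f = sumℤ (map f xs)

∑-cong : ∀ (xs : List A) {f g : A → ℤ} → (∀ {x} → x ∈ xs → f x ≡ g x) → ∑ xs f ≡ ∑ xs g
∑-cong []       h = refl
∑-cong (x ∷ xs) h = cong₂ _+_ (h (here refl)) (∑-cong xs (h ∘ there))

∑-ext : ∀ (xs : List A) {f g : A → ℤ} → (∀ x → f x ≡ g x) → ∑ xs f ≡ ∑ xs g
∑-ext xs h = ∑-cong xs (λ {x} _ → h x)

∑-upTo-cong : ∀ n {f g : ℕ → ℤ} → (∀ i → i < n → f i ≡ g i) → ∑ (upTo n) f ≡ ∑ (upTo n) g
∑-upTo-cong n h = ∑-cong (upTo n) (λ {i} i∈ → h i (∈-upTo⁻ i∈))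

∑-filterᵇ-cong : ∀ (p : A → Bool) xs {f g : A → ℤ} → (∀ x → T (p x) → f x ≡ g x) →
                 ∑ (filterᵇ p xs) f ≡ ∑ (filterᵇ p xs) g
∑-filterᵇ-cong p xs h =
  ∑-cong (filterᵇ p xs) (λ {x} x∈ → h x (proj₂ (∈-filter⁻ (T? ∘ p) {xs = xs} x∈)))

∑-0 : ∀ (xs : List A) → ∑ xs (λ _ → 0ℤ) ≡ 0ℤ
∑-0 []       = refl
∑-0 (x ∷ xs) = trans (ℤₚ.+-identityˡ _) (∑-0 xs)

interchange : ∀ a b c d → (a + b) + (c + d) ≡ (a + c) + (b + d)
interchange = solve-∀

∑-+ : ∀ (xs : List A) (f g : A → ℤ) → ∑ xs (λ x → f x + g x) ≡ ∑ xs f + ∑ xs g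
∑-+ []       f g = refl
∑-+ (x ∷ xs) f g = trans (cong (f x + g x +_) (∑-+ xs f g)) (interchange (f x) (g x) _ _)

∑-*ˡ : ∀ (xs : List A) c (f : A → ℤ) → ∑ xs (λ x → c * f x) ≡ c * ∑ xs f
∑-*ˡ []       c f = sym (ℤₚ.*-zeroʳ c)
∑-*ˡ (x ∷ xs) c f =
  trans (cong (c * f x +_) (∑-*ˡ xs c f)) (sym (ℤₚ.*-distribˡ-+ c (f x) _))

∑-*ʳ : ∀ (xs : List A) c (f : A → ℤ) → ∑ xs (λ x → f x * c) ≡ ∑ xs f * c
∑-*ʳ xs c f = trans (∑-ext xs (λ x → ℤₚ.*-comm (f x) c)) (trans (∑-*ˡ xs c f) (ℤₚ.*-comm c _))

∑-neg : ∀ (xs : List A) (f : A → ℤ) → ∑ xs (λ x → - f x) ≡ - ∑ xs f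
∑-neg []       f = refl
∑-neg (x ∷ xs) f = trans (cong (- f x +_) (∑-neg xs f)) (sym (ℤₚ.neg-distrib-+ (f x) _))

∑-swap : ∀ (xs : List A) (ys : List B) (f : A → B → ℤ) →
         ∑ xs (λ x → ∑ ys (f x)) ≡ ∑ ys (λ y → ∑ xs (λ x → f x y))
∑-swap []       ys f = sym (∑-0 ys)
∑-swap (x ∷ xs) ys f =
  trans (cong (∑ ys (f x) +_) (∑-swap xs ys f)) (sym (∑-+ ys (f x) _))

∑-++ : ∀ (xs ys : List A) (f : A → ℤ) → ∑ (xs ++ ys) f ≡ ∑ xs f + ∑ ys f
∑-++ []       ys f = sym (ℤₚ.+-identityˡ _)
∑-++ (x ∷ xs) ys f = trans (cong (f x +_) (∑-++ xs ys f)) (sym (ℤₚ.+-assoc (f x) _ _))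

∑-map : ∀ (h : A → B) xs (f : B → ℤ) → ∑ (map h xs) f ≡ ∑ xs (f ∘ h)
∑-map h xs f = cong sumℤ (sym (Listₚ.map-∘ xs))

∑-concatMap : ∀ (h : A → List B) xs (f : B → ℤ) → ∑ (concatMap h xs) f ≡ ∑ xs (λ x → ∑ (h x) f)
∑-concatMap h []       f = refl
∑-concatMap h (x ∷ xs) f =
  trans (∑-++ (h x) (concatMap h xs) f) (cong (∑ (h x) f +_) (∑-concatMap h xs f))

∑-cartesianProduct : ∀ (xs : List A) (ys : List B) (f : A × B → ℤ) →
                     ∑ (cartesianProduct xs ys) f ≡ ∑ xs (λ x → ∑ ys (λ y → f (x , y)))
∑-cartesianProduct []       ys f = refl
∑-cartesianProduct (x ∷ xs) ys f =
  trans (∑-++ (map (x ,_) ys) _ f)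
        (cong₂ _+_ (∑-map (x ,_) ys f) (∑-cartesianProduct xs ys f))

𝟙 : Bool → ℤ
𝟙 b = if b then 1ℤ else 0ℤ

∑-filterᵇ : ∀ (p : A → Bool) xs (f : A → ℤ) → ∑ (filterᵇ p xs) f ≡ ∑ xs (λ x → 𝟙 (p x) * f x)
∑-filterᵇ p []       f = refl
∑-filterᵇ p (x ∷ xs) f with p x
... | true  = cong₂ _+_ (sym (ℤₚ.*-identityˡ (f x))) (∑-filterᵇ p xs f)
... | false = trans (∑-filterᵇ p xs f) (sym (ℤₚ.+-identityˡ _))

length-filterᵇ : ∀ (p : A → Bool) xs → pos (length (filterᵇ p xs)) ≡ ∑ xs (𝟙 ∘ p)
length-filterᵇ p []       = refl
length-filterᵇ p (x ∷ xs) with p x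
... | true  = cong (1ℤ +_) (length-filterᵇ p xs)
... | false = trans (length-filterᵇ p xs) (sym (ℤₚ.+-identityˡ _))

∑-applyUpTo : ∀ n (h : ℕ → A) (f : A → ℤ) → ∑ (applyUpTo h n) f ≡ ∑ (upTo n) (f ∘ h)
∑-applyUpTo n h f =
  trans (cong (λ l → ∑ l f) (sym (Listₚ.map-applyUpTo id h n))) (∑-map h (upTo n) f)

∑-first : ∀ n (f : ℕ → ℤ) → ∑ (upTo (suc n)) f ≡ f 0 + ∑ (upTo n) (f ∘ suc)
∑-first n f = cong (f 0 +_) (∑-applyUpTo n suc f)

∑-last : ∀ n (f : ℕ → ℤ) → ∑ (upTo (suc n)) f ≡ ∑ (upTo n) f + f n
∑-last n f =
  trans (cong (λ l → ∑ l f) (sym (Listₚ.upTo-∷ʳ n)))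
        (trans (∑-++ (upTo n) (n ∷ []) f) (cong (∑ (upTo n) f +_) (ℤₚ.+-identityʳ (f n))))

∑-δ : ∀ {n k} (f : ℕ → ℤ) → k < n → ∑ (upTo n) (λ i → 𝟙 (i ≡ᵇ k) * f i) ≡ f k
∑-δ {suc n} {zero} f _ = begin
  ∑ (upTo (suc n)) (λ i → 𝟙 (i ≡ᵇ 0) * f i)          ≡⟨ ∑-first n (λ i → 𝟙 (i ≡ᵇ 0) * f i) ⟩
  1ℤ * f 0 + ∑ (upTo n) (λ i → 0ℤ)                   ≡⟨ cong₂ _+_ (ℤₚ.*-identityˡ (f 0)) (∑-0 (upTo n)) ⟩
  f 0 + 0ℤ                                           ≡⟨ ℤₚ.+-identityʳ (f 0) ⟩
  f 0                                                ∎ where open ≡-Reasoning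
∑-δ {suc n} {suc k} f (s≤s k<n) =
  trans (∑-first n (λ i → 𝟙 (i ≡ᵇ suc k) * f i)) (trans (ℤₚ.+-identityˡ _) (∑-δ (f ∘ suc) k<n))

-- Formal power series

opaque
  infixl 7 _⊛_

  -- Opaque, as otherwise comparing two products unfolds them down to their coefficients.
  _⊛_ : FPS → FPS → FPS
  _⊛_ = Defs._⊛_

  ⊛-Defs : ∀ f g → f ⊛ g ≡ f Defs.⊛ g
  ⊛-Defs f g = refl

⊛-coefficient : ∀ f g n → (f ⊛ g) n ≡ ∑ (upTo (suc n)) (λ i → f i * g (n ∸ i))
⊛-coefficient f g n = cong (λ h → h n) (⊛-Defs f g)

tail : FPS → FPS
tail f = f ∘ suc

⊛-zero : ∀ f g → (f ⊛ g) 0 ≡ f 0 * g 0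
⊛-zero f g = trans (⊛-coefficient f g 0) (ℤₚ.+-identityʳ _)

⊛-suc : ∀ f g n → (f ⊛ g) (suc n) ≡ f 0 * g (suc n) + (tail f ⊛ g) n
⊛-suc f g n = trans (⊛-coefficient f g (suc n))
  (trans (∑-first (suc n) (λ i → f i * g (suc n ∸ i)))
         (cong (f 0 * g (suc n) +_) (sym (⊛-coefficient (tail f) g n))))

-- The mirror image of `⊛-suc`. Peeling one product from the left and the other from the right is
-- what makes commutativity a plain induction.
⊛-sucʳ : ∀ f g n → (f ⊛ g) (suc n) ≡ f (suc n) * g 0 + (f ⊛ tail g) n
⊛-sucʳ f g zero    = begin
  (f ⊛ g) 1                                ≡⟨ ⊛-suc f g 0 ⟩
  f 0 * g 1 + (tail f ⊛ g) 0               ≡⟨ cong (f 0 * g 1 +_) (⊛-zero (tail f) g) ⟩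
  f 0 * g 1 + f 1 * g 0                    ≡⟨ ℤₚ.+-comm (f 0 * g 1) _ ⟩
  f 1 * g 0 + f 0 * g 1                    ≡⟨ cong (f 1 * g 0 +_) (⊛-zero f (tail g)) ⟨
  f 1 * g 0 + (f ⊛ tail g) 0               ∎ where open ≡-Reasoning
⊛-sucʳ f g (suc n) = begin
  (f ⊛ g) (2 ℕ.+ n)                        ≡⟨ ⊛-suc f g (suc n) ⟩
  a + (tail f ⊛ g) (suc n)                 ≡⟨ cong (a +_) (⊛-sucʳ (tail f) g n) ⟩
  a + (b + (tail f ⊛ tail g) n)            ≡⟨ swap a b _ ⟩
  b + (a + (tail f ⊛ tail g) n)            ≡⟨ cong (b +_) (⊛-suc f (tail g) n) ⟨
  b + (f ⊛ tail g) (suc n)                 ∎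
  where
  open ≡-Reasoning
  a = f 0 * g (2 ℕ.+ n)
  b = f (2 ℕ.+ n) * g 0
  swap : ∀ x y z → x + (y + z) ≡ y + (x + z)
  swap = solve-∀

⊛-cong-≤ : ∀ {f f′ g g′} n → (∀ i → i ≤ n → f i ≡ f′ i) → (∀ i → i ≤ n → g i ≡ g′ i) →
           (f ⊛ g) n ≡ (f′ ⊛ g′) n
⊛-cong-≤ {f} {f′} {g} {g′} n p r = trans (⊛-coefficient f g n) (trans
  (∑-upTo-cong (suc n) λ i i<1+n → cong₂ _*_ (p i (ℕₚ.≤-pred i<1+n)) (r (n ∸ i) (ℕₚ.m∸n≤m n i)))
  (sym (⊛-coefficient f′ g′ n)))

⊛-congˡ : ∀ {f f′} g n → f ≐ f′ → (f ⊛ g) n ≡ (f′ ⊛ g) n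
⊛-congˡ g n p = ⊛-cong-≤ {g = g} n (λ i _ → p i) (λ _ _ → refl)

⊛-comm : ∀ f g → f ⊛ g ≐ g ⊛ f
⊛-comm f g zero    = trans (⊛-zero f g) (trans (ℤₚ.*-comm (f 0) (g 0)) (sym (⊛-zero g f)))
⊛-comm f g (suc n) =
  trans (⊛-suc f g n)
        (trans (cong₂ _+_ (ℤₚ.*-comm (f 0) (g (suc n))) (⊛-comm (tail f) g n))
               (sym (⊛-sucʳ g f n)))

⊛-distribʳ-⊕ : ∀ h f g → (f ⊕ g) ⊛ h ≐ (f ⊛ h) ⊕ (g ⊛ h)
⊛-distribʳ-⊕ h f g n = begin
  ((f ⊕ g) ⊛ h) n
    ≡⟨ ⊛-coefficient (f ⊕ g) h n ⟩
  ∑ (upTo (suc n)) (λ i → (f i + g i) * h (n ∸ i))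
    ≡⟨ ∑-ext (upTo (suc n)) (λ i → ℤₚ.*-distribʳ-+ (h (n ∸ i)) (f i) (g i)) ⟩
  ∑ (upTo (suc n)) (λ i → f i * h (n ∸ i) + g i * h (n ∸ i))
    ≡⟨ ∑-+ (upTo (suc n)) (λ i → f i * h (n ∸ i)) _ ⟩
  ∑ (upTo (suc n)) (λ i → f i * h (n ∸ i)) + ∑ (upTo (suc n)) (λ i → g i * h (n ∸ i))
    ≡⟨ cong₂ _+_ (⊛-coefficient f h n) (⊛-coefficient g h n) ⟨
  (f ⊛ h) n + (g ⊛ h) n ∎
  where open ≡-Reasoning

scale-⊛ : ∀ c f g n → ((λ i → c * f i) ⊛ g) n ≡ c * (f ⊛ g) n
scale-⊛ c f g n = begin
  ((λ i → c * f i) ⊛ g) n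
    ≡⟨ ⊛-coefficient (λ i → c * f i) g n ⟩
  ∑ (upTo (suc n)) (λ i → c * f i * g (n ∸ i))
    ≡⟨ ∑-ext (upTo (suc n)) (λ i → ℤₚ.*-assoc c (f i) (g (n ∸ i))) ⟩
  ∑ (upTo (suc n)) (λ i → c * (f i * g (n ∸ i)))
    ≡⟨ ∑-*ˡ (upTo (suc n)) c (λ i → f i * g (n ∸ i)) ⟩
  c * ∑ (upTo (suc n)) (λ i → f i * g (n ∸ i))
    ≡⟨ cong (c *_) (⊛-coefficient f g n) ⟨
  c * (f ⊛ g) n ∎
  where open ≡-Reasoning

-- Induction on the degree: the tail of f ⊛ g is f(0) · tail g + tail f ⊛ g, so associativity one
-- degree lower suffices and no double sum has to be rearranged.
⊛-assoc : ∀ f g h → (f ⊛ g) ⊛ h ≐ f ⊛ (g ⊛ h)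
⊛-assoc f g h zero = begin
  ((f ⊛ g) ⊛ h) 0       ≡⟨ ⊛-zero (f ⊛ g) h ⟩
  (f ⊛ g) 0 * h 0       ≡⟨ cong (_* h 0) (⊛-zero f g) ⟩
  f 0 * g 0 * h 0       ≡⟨ ℤₚ.*-assoc (f 0) (g 0) (h 0) ⟩
  f 0 * (g 0 * h 0)     ≡⟨ cong (f 0 *_) (⊛-zero g h) ⟨
  f 0 * (g ⊛ h) 0       ≡⟨ ⊛-zero f (g ⊛ h) ⟨
  (f ⊛ (g ⊛ h)) 0       ∎ where open ≡-Reasoning
⊛-assoc f g h (suc n) = begin
  ((f ⊛ g) ⊛ h) (suc n)
    ≡⟨ ⊛-suc (f ⊛ g) h n ⟩
  (f ⊛ g) 0 * h (suc n) + (tail (f ⊛ g) ⊛ h) n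
    ≡⟨ cong₂ (λ a b → a * h (suc n) + b) (⊛-zero f g) (⊛-congˡ h n (⊛-suc f g)) ⟩
  f 0 * g 0 * h (suc n) + (((λ i → f 0 * tail g i) ⊕ tail f ⊛ g) ⊛ h) n
    ≡⟨ cong (f 0 * g 0 * h (suc n) +_) (⊛-distribʳ-⊕ h (λ i → f 0 * tail g i) (tail f ⊛ g) n) ⟩
  f 0 * g 0 * h (suc n) + (((λ i → f 0 * tail g i) ⊛ h) n + ((tail f ⊛ g) ⊛ h) n)
    ≡⟨ cong (f 0 * g 0 * h (suc n) +_) (cong₂ _+_ (scale-⊛ (f 0) (tail g) h n) (⊛-assoc (tail f) g h n)) ⟩
  f 0 * g 0 * h (suc n) + (f 0 * (tail g ⊛ h) n + (tail f ⊛ (g ⊛ h)) n)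
    ≡⟨ regroup (f 0) (g 0) (h (suc n)) _ _ ⟩
  f 0 * (g 0 * h (suc n) + (tail g ⊛ h) n) + (tail f ⊛ (g ⊛ h)) n
    ≡⟨ cong (λ a → f 0 * a + (tail f ⊛ (g ⊛ h)) n) (⊛-suc g h n) ⟨
  f 0 * (g ⊛ h) (suc n) + (tail f ⊛ (g ⊛ h)) n
    ≡⟨ ⊛-suc f (g ⊛ h) n ⟨
  (f ⊛ (g ⊛ h)) (suc n) ∎
  where
  open ≡-Reasoning
  regroup : ∀ a b c d e → a * b * c + (a * d + e) ≡ a * (b * c + d) + e
  regroup = solve-∀

0⊛ : ∀ f n → ((λ _ → 0ℤ) ⊛ f) n ≡ 0ℤ
0⊛ f n = trans (⊛-coefficient (λ _ → 0ℤ) f n) (∑-0 (upTo (suc n)))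

⟨⟩-⊛ : ∀ c f n → (⟨ c ⟩ ⊛ f) n ≡ c * f n
⟨⟩-⊛ c f zero    = ⊛-zero ⟨ c ⟩ f
⟨⟩-⊛ c f (suc n) =
  trans (⊛-suc ⟨ c ⟩ f n) (trans (cong (c * f (suc n) +_) (0⊛ f n)) (ℤₚ.+-identityʳ _))

⊛-identityˡ : ∀ f → ⟨ 1ℤ ⟩ ⊛ f ≐ f
⊛-identityˡ f n = trans (⟨⟩-⊛ 1ℤ f n) (ℤₚ.*-identityˡ (f n))

q^-0 : q^ 0 ≐ ⟨ 1ℤ ⟩
q^-0 zero    = refl
q^-0 (suc _) = refl

q^-⊛-shift : ∀ k f n → (q^ k ⊛ f) (k ℕ.+ n) ≡ f n
q^-⊛-shift zero    f n = trans (⊛-congˡ f n q^-0) (⊛-identityˡ f n)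
q^-⊛-shift (suc k) f n =
  trans (⊛-suc (q^ (suc k)) f (k ℕ.+ n)) (trans (ℤₚ.+-identityˡ _) (q^-⊛-shift k f n))

q^-⊛-< : ∀ k f n → n < k → (q^ k ⊛ f) n ≡ 0ℤ
q^-⊛-< (suc k) f zero    _         = ⊛-zero (q^ (suc k)) f
q^-⊛-< (suc k) f (suc n) (s≤s n<k) =
  trans (⊛-suc (q^ (suc k)) f n) (trans (ℤₚ.+-identityˡ _) (q^-⊛-< k f n n<k))

q^-+ : ∀ j k → q^ (j ℕ.+ k) ≐ q^ j ⊛ q^ k
q^-+ zero    k n       = sym (trans (⊛-congˡ (q^ k) n q^-0) (⊛-identityˡ (q^ k) n))
q^-+ (suc j) k zero    = sym (⊛-zero (q^ (suc j)) (q^ k))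
q^-+ (suc j) k (suc n) =
  sym (trans (⊛-suc (q^ (suc j)) (q^ k) n) (trans (ℤₚ.+-identityˡ _) (sym (q^-+ j k n))))

-- The list of earlier coefficients behind inv is private to Defs. Abstracting sumℤ and zipWith
-- turns them into variables, after which unification recovers that list.
module Inverse (f : FPS) where
  earlier : ∀ n → Σ (List ℤ) λ gs →
            inv f (suc n) ≡ - sumℤ (zipWith (λ i g → f (suc i) * g) (upTo (suc n)) gs)
  earlier n with sumℤ | zipWith (λ i g → f (suc i) * g)
  ... | _ | _ = _ , refl

  upToDegree : ℕ → List ℤ
  upToDegree n = proj₁ (earlier n)

  -- The index list is generalised to `applyUpTo h`, because its tail in the induction is no longer
  -- of the form `upTo`. The recovered list is in decreasing order of degree, so position i holds
  -- the coefficient of degree n - i and the sum is a convolution.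
  zipWith-upToDegree : ∀ n (h : ℕ → ℕ) →
    sumℤ (zipWith (λ i g → f (suc i) * g) (applyUpTo h (suc n)) (upToDegree n)) ≡
    ∑ (upTo (suc n)) (λ i → f (suc (h i)) * inv f (n ∸ i))
  zipWith-upToDegree zero    h = refl
  zipWith-upToDegree (suc n) h =
    trans (cong (f (suc (h 0)) * inv f (suc n) +_) (zipWith-upToDegree n (h ∘ suc)))
          (sym (∑-first (suc n) (λ i → f (suc (h i)) * inv f (suc n ∸ i))))

  inv-suc : ∀ n → inv f (suc n) ≡ - (tail f ⊛ inv f) n
  inv-suc n = trans (proj₂ (earlier n))
    (cong -_ (trans (zipWith-upToDegree n id) (sym (⊛-coefficient (tail f) (inv f) n))))

  ⊛-inverseʳ : f 0 ≡ 1ℤ → f ⊛ inv f ≐ ⟨ 1ℤ ⟩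
  ⊛-inverseʳ f0 zero    = trans (⊛-zero f (inv f)) (cong (_* 1ℤ) f0)
  ⊛-inverseʳ f0 (suc n) = begin
    (f ⊛ inv f) (suc n)                        ≡⟨ ⊛-suc f (inv f) n ⟩
    f 0 * inv f (suc n) + r                    ≡⟨ cong₂ (λ a b → a * b + r) f0 (inv-suc n) ⟩
    1ℤ * (- r) + r                             ≡⟨ cong (_+ r) (ℤₚ.*-identityˡ (- r)) ⟩
    - r + r                                    ≡⟨ ℤₚ.+-inverseˡ r ⟩
    0ℤ                                         ∎
    where
    open ≡-Reasoning
    r = (tail f ⊛ inv f) n

open Inverse public using (⊛-inverseʳ)

-- The ring of power series modulo q^(N+1)

record _≈[_]_ (f : FPS) (N : ℕ) (g : FPS) : Set where
  constructor mod
  field at : ∀ n → n ≤ N → f n ≡ g n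
open _≈[_]_ public
infix 4 _≈[_]_

≐⇒≈ : ∀ {N f g} → f ≐ g → f ≈[ N ] g
≐⇒≈ h = mod λ n _ → h n

≈⇒≐ : ∀ {f g} → (∀ N → f ≈[ N ] g) → f ≐ g
≈⇒≐ h n = at (h n) n ℕₚ.≤-refl

truncated : ℕ → CommutativeRing 0ℓ 0ℓ
truncated N = record
  { Carrier = FPS
  ; _≈_     = _≈[ N ]_
  ; _+_     = _⊕_
  ; _*_     = _⊛_
  ; -_      = λ f n → - f n
  ; 0#      = λ _ → 0ℤ
  ; 1#      = ⟨ 1ℤ ⟩
  ; isCommutativeRing = record
    { isRing = record
      { +-isAbelianGroup = record
        { isGroup = record
          { isMonoid = record
            { isSemigroup = record
              { isMagma = record
                { isEquivalence = record
                  { refl  = ≐⇒≈ λ _ → refl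
                  ; sym   = λ p → mod λ n n≤N → sym (at p n n≤N)
                  ; trans = λ p r → mod λ n n≤N → trans (at p n n≤N) (at r n n≤N)
                  }
                ; ∙-cong = λ p r → mod λ n n≤N → cong₂ _+_ (at p n n≤N) (at r n n≤N)
                }
              ; assoc = λ f g h → ≐⇒≈ λ n → ℤₚ.+-assoc (f n) (g n) (h n)
              }
            ; identity = (λ f → ≐⇒≈ λ n → ℤₚ.+-identityˡ (f n))
                       , (λ f → ≐⇒≈ λ n → ℤₚ.+-identityʳ (f n))
            }
          ; inverse = (λ f → ≐⇒≈ λ n → ℤₚ.+-inverseˡ (f n))
                    , (λ f → ≐⇒≈ λ n → ℤₚ.+-inverseʳ (f n))
          ; ⁻¹-cong = λ p → mod λ n n≤N → cong -_ (at p n n≤N)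
          }
        ; comm = λ f g → ≐⇒≈ λ n → ℤₚ.+-comm (f n) (g n)
        }
      ; *-cong     = λ p r → mod λ n n≤N →
                       ⊛-cong-≤ n (λ i i≤n → at p i (ℕₚ.≤-trans i≤n n≤N))
                                  (λ i i≤n → at r i (ℕₚ.≤-trans i≤n n≤N))
      ; *-assoc    = λ f g h → ≐⇒≈ (⊛-assoc f g h)
      ; *-identity = (λ f → ≐⇒≈ (⊛-identityˡ f))
                   , (λ f → ≐⇒≈ λ n → trans (⊛-comm f ⟨ 1ℤ ⟩ n) (⊛-identityˡ f n))
      ; distrib    = (λ f g h → ≐⇒≈ λ n →
                        trans (⊛-comm f (g ⊕ h) n)
                              (trans (⊛-distribʳ-⊕ f g h n)
                                     (cong₂ _+_ (⊛-comm g f n) (⊛-comm h f n))))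
                   , (λ f g h → ≐⇒≈ (⊛-distribʳ-⊕ f g h))
      }
    ; *-comm = λ f g → ≐⇒≈ (⊛-comm f g)
    }
  }

q^-vanish : ∀ {N k} → N < k → q^ k ≈[ N ] (λ _ → 0ℤ)
q^-vanish {N} {k} N<k = mod λ n n≤N →
  trans (sym (trans (⊛-comm (q^ k) ⟨ 1ℤ ⟩ n) (⊛-identityˡ (q^ k) n)))
        (q^-⊛-< k ⟨ 1ℤ ⟩ n (ℕₚ.≤-<-trans n≤N N<k))

-- Boolean conditions and their indicators

T-ext : ∀ {a b} → (T a → T b) → (T b → T a) → a ≡ b
T-ext {false} {false} f g = refl
T-ext {false} {true}  f g = ⊥-elim (g tt)
T-ext {true}  {false} f g = ⊥-elim (f tt)
T-ext {true}  {true}  f g = refl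

∧-intro : ∀ {a b} → T a → T b → T (a ∧ b)
∧-intro p q = Equivalence.from T-∧ (p , q)

∧-elim : ∀ {a b} → T (a ∧ b) → T a × T b
∧-elim = Equivalence.to T-∧

𝟙-∧ : ∀ a b → 𝟙 (a ∧ b) ≡ 𝟙 a * 𝟙 b
𝟙-∧ true  b = sym (ℤₚ.*-identityˡ (𝟙 b))
𝟙-∧ false b = refl

≡ᵇ-refl : ∀ n → T (n ≡ᵇ n)
≡ᵇ-refl n = ℕₚ.≡⇒≡ᵇ n n refl

≡ᵇ-cancelˡ : ∀ x m n → (x ℕ.+ m ≡ᵇ x ℕ.+ n) ≡ (m ≡ᵇ n)
≡ᵇ-cancelˡ zero    m n = refl
≡ᵇ-cancelˡ (suc x) m n = ≡ᵇ-cancelˡ x m n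

𝟙-≤ᵇ-suc : ∀ x k → 𝟙 (x ≤ᵇ suc k) ≡ 𝟙 (x ≤ᵇ k) + 𝟙 (x ≡ᵇ suc k)
𝟙-≤ᵇ-suc zero          k       = refl
𝟙-≤ᵇ-suc (suc zero)    zero    = refl
𝟙-≤ᵇ-suc (suc (suc x)) zero    = refl
𝟙-≤ᵇ-suc (suc zero)    (suc k) = refl
𝟙-≤ᵇ-suc (suc (suc x)) (suc k) = 𝟙-≤ᵇ-suc (suc x) k

-- Partitions whose even parts are distinct, as lists

-- The largest part that may follow x in a non-increasing list: an odd part may be repeated, an even
-- one may not.
allowedBelow : ℕ → ℕ
allowedBelow x = if isEven x then x ∸ 1 else x

allowedBelow-≤ : ∀ x → allowedBelow x ≤ x
allowedBelow-≤ x with isEven x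
... | true  = ℕₚ.m∸n≤m x 1
... | false = ℕₚ.≤-refl

-- Distinctness of even parts is stated in the definitions by counting over the whole list. Here it
-- is a condition on neighbouring parts, checked from the head, so that a sum over lists can be
-- split by the first entry.
admissible : (ℕ → Bool) → ℕ → List ℕ → Bool
admissible A k []       = true
admissible A k (x ∷ xs) = (x ≤ᵇ k) ∧ A x ∧ admissible A (allowedBelow x) xs

count-∷-≤ : ∀ p x xs → count p xs ≤ count p (x ∷ xs)
count-∷-≤ p x xs with p ≡ᵇ x
... | true  = ℕₚ.n≤1+n _
... | false = ℕₚ.≤-refl

count-∷-≢ : ∀ {p x} xs → p ≢ x → count p (x ∷ xs) ≡ count p xs
count-∷-≢ {p} {x} xs p≢x with p ≡ᵇ x in eq
... | true  = ⊥-elim (p≢x (ℕₚ.≡ᵇ⇒≡ p x (subst T (sym eq) tt)))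
... | false = refl

count-self : ∀ x xs → count x (x ∷ xs) ≡ suc (count x xs)
count-self x xs rewrite Equivalence.to T-≡ (≡ᵇ-refl x) = refl

count≡0⇒≢ : ∀ {p} xs → count p xs ≡ 0 → All (_≢ p) xs
count≡0⇒≢ []       _ = []
count≡0⇒≢ {p} (x ∷ xs) h with p ≡ᵇ x in eq
... | false = (λ { refl → subst T eq (≡ᵇ-refl p) }) ∷ count≡0⇒≢ xs h

count-< : ∀ {p} xs → All (_< p) xs → count p xs ≡ 0
count-< []       []         = refl
count-< (x ∷ xs) (x<p ∷ h) = trans (count-∷-≢ xs (ℕₚ.>⇒≢ x<p)) (count-< xs h)

nonIncreasing-∷⁻ : ∀ x xs → T (nonIncreasing (x ∷ xs)) → All (_≤ x) xs × T (nonIncreasing xs)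
nonIncreasing-∷⁻ x []       h = [] , tt
nonIncreasing-∷⁻ x (y ∷ ys) h =
  let y≤ᵇx , rest = ∧-elim {y ≤ᵇ x} h
      y≤x = ℕₚ.≤ᵇ⇒≤ y x y≤ᵇx
      ys≤y , _ = nonIncreasing-∷⁻ y ys rest
  in (y≤x ∷ All.map (λ z≤y → ℕₚ.≤-trans z≤y y≤x) ys≤y) , rest

nonIncreasing-∷⁺ : ∀ x xs → All (_≤ x) xs → T (nonIncreasing xs) → T (nonIncreasing (x ∷ xs))
nonIncreasing-∷⁺ x []       _         _ = tt
nonIncreasing-∷⁺ x (y ∷ ys) (y≤x ∷ _) h = ∧-intro (ℕₚ.≤⇒≤ᵇ y≤x) h

DistinctIn : List ℕ → ℕ → Set
DistinctIn xs p = T (isEven p) → count p xs ≤ 1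

evenPartsDistinct⁻ : ∀ xs → T (evenPartsDistinct xs) → All (DistinctIn xs) xs
evenPartsDistinct⁻ xs h = All.map (λ {p} → conv {p}) (Allₚ.all⁺ _ xs h)
  where
  conv : ∀ {p} → T (not (isEven p) ∨ (count p xs ≤ᵇ 1)) → DistinctIn xs p
  conv {p} d with isEven p
  ... | true  = λ _ → ℕₚ.≤ᵇ⇒≤ (count p xs) 1 d
  ... | false = λ ()

evenPartsDistinct⁺ : ∀ xs → All (DistinctIn xs) xs → T (evenPartsDistinct xs)
evenPartsDistinct⁺ xs h = Allₚ.all⁻ _ (All.map (λ {p} → conv {p}) h)
  where
  conv : ∀ {p} → DistinctIn xs p → T (not (isEven p) ∨ (count p xs ≤ᵇ 1))
  conv {p} d with isEven p
  ... | true  = ℕₚ.≤⇒≤ᵇ (d tt)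
  ... | false = tt

record Admissible (A : ℕ → Bool) (k : ℕ) (xs : List ℕ) : Set where
  constructor adm
  field
    bounded  : All (_≤ k) xs
    ordered  : T (nonIncreasing xs)
    allowed  : All (T ∘ A) xs
    distinct : T (evenPartsDistinct xs)

≤-allowedBelow : ∀ x xs → All (_≤ x) xs → DistinctIn (x ∷ xs) x → All (_≤ allowedBelow x) xs
≤-allowedBelow x xs xs≤x d with isEven x
... | false = xs≤x
... | true  = All.zipWith (λ (y≤x , y≢x) → ℕₚ.<⇒≤pred (ℕₚ.≤∧≢⇒< y≤x y≢x)) (xs≤x , xs≢x)
  where
  xs≢x : All (_≢ x) xs
  xs≢x = count≡0⇒≢ xs (ℕₚ.n≤0⇒n≡0 (ℕₚ.≤-pred (subst (_≤ 1) (count-self x xs) (d tt))))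

-- The bound on x matters: 0 is even and 0 ∸ 1 = 0, so a part 0 could follow itself. The hypothesis
-- `A 0 ≡ false` in the lemmas below excludes this case.
allowedBelow-even : ∀ {x} → 1 ≤ x → T (isEven x) → ∀ {y} → y ≤ allowedBelow x → y < x
allowedBelow-even {suc x} _ e y≤ with isEven (suc x)
... | true = s≤s y≤

admissible⁻ : ∀ {A} → A 0 ≡ false → ∀ k xs → T (admissible A k xs) → Admissible A k xs
admissible⁻ A0 k []       _ = adm [] tt [] tt
admissible⁻ {A} A0 k (x ∷ xs) h =
  let x≤ᵇk , h₁ = ∧-elim {x ≤ᵇ k} h
      Ax , h₂ = ∧-elim {A x} h₁
      adm bounded ordered allowed distinct = admissible⁻ A0 (allowedBelow x) xs h₂
      x≤k = ℕₚ.≤ᵇ⇒≤ x k x≤ᵇk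
      xs≤x = All.map (λ y≤ → ℕₚ.≤-trans y≤ (allowedBelow-≤ x)) bounded
  in adm (x≤k ∷ All.map (λ y≤x → ℕₚ.≤-trans y≤x x≤k) xs≤x)
         (nonIncreasing-∷⁺ x xs xs≤x ordered)
         (Ax ∷ allowed)
         (evenPartsDistinct⁺ (x ∷ xs)
           ((λ e → subst (_≤ 1) (sym (trans (count-self x xs) (cong suc (count-< xs (All.map (allowedBelow-even (positive Ax) e) bounded))))) ℕₚ.≤-refl)
           ∷ All.zipWith (λ (d , y≤) e → subst (_≤ 1) (sym (count-∷-≢ xs (differ Ax e y≤))) (d e))
                         (evenPartsDistinct⁻ xs distinct , bounded)))
  where
  positive : ∀ {x} → T (A x) → 1 ≤ x
  positive {zero}  Ax = ⊥-elim (subst T A0 Ax)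
  positive {suc x} _  = s≤s z≤n

  differ : ∀ {x y} → T (A x) → T (isEven y) → y ≤ allowedBelow x → y ≢ x
  differ Ax e y≤ refl = ℕₚ.<-irrefl refl (allowedBelow-even (positive Ax) e y≤)

admissible⁺ : ∀ {A} k xs → Admissible A k xs → T (admissible A k xs)
admissible⁺ k []       _ = tt
admissible⁺ k (x ∷ xs) (adm (x≤k ∷ _) ordered (Ax ∷ allowed) distinct) =
  let xs≤x , ordered′ = nonIncreasing-∷⁻ x xs ordered
      ds = evenPartsDistinct⁻ (x ∷ xs) distinct
  in ∧-intro (ℕₚ.≤⇒≤ᵇ x≤k) (∧-intro Ax (admissible⁺ (allowedBelow x) xs
       (adm (≤-allowedBelow x xs xs≤x (All.head ds)) ordered′ allowed
            (evenPartsDistinct⁺ xs (All.map (λ {p} d e → ℕₚ.≤-trans (count-∷-≤ p x xs) (d e)) (All.tail ds))))))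

≤-sumℕ : ∀ xs → All (_≤ sumℕ xs) xs
≤-sumℕ []       = []
≤-sumℕ (x ∷ xs) =
  ℕₚ.m≤m+n x (sumℕ xs) ∷ All.map (λ y≤ → ℕₚ.≤-trans y≤ (ℕₚ.m≤n+m (sumℕ xs) x)) (≤-sumℕ xs)

-- Parts of a partition of m are at most m, so starting with the bound m is no restriction;
-- conversely, positivity of the parts comes from `A 0 ≡ false`.
partition⇔admissible : ∀ {A} → A 0 ≡ false → ∀ m xs →
  isPartitionOf m xs ∧ (all A xs ∧ evenPartsDistinct xs) ≡ (sumℕ xs ≡ᵇ m) ∧ admissible A m xs
partition⇔admissible {A} A0 m xs = T-ext to from
  where
  to : T (isPartitionOf m xs ∧ (all A xs ∧ evenPartsDistinct xs)) → T ((sumℕ xs ≡ᵇ m) ∧ admissible A m xs)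
  to h =
    let part , rest = ∧-elim {isPartitionOf m xs} h
        _ , part′ = ∧-elim {all (1 ≤ᵇ_) xs} part
        ordered , sum≡ = ∧-elim {nonIncreasing xs} part′
        allowed , distinct = ∧-elim {all A xs} rest
    in ∧-intro sum≡ (admissible⁺ m xs
         (adm (subst (λ s → All (_≤ s) xs) (ℕₚ.≡ᵇ⇒≡ (sumℕ xs) m sum≡) (≤-sumℕ xs))
              ordered (Allₚ.all⁺ A xs allowed) distinct))
  positive : ∀ {x} → T (A x) → T (1 ≤ᵇ x)
  positive {zero}  Ax = subst T A0 Ax
  positive {suc x} _  = tt
  from : T ((sumℕ xs ≡ᵇ m) ∧ admissible A m xs) → T (isPartitionOf m xs ∧ (all A xs ∧ evenPartsDistinct xs))
  from h =
    let sum≡ , a = ∧-elim {sumℕ xs ≡ᵇ m} h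
        adm _ ordered allowed distinct = admissible⁻ A0 m xs a
    in ∧-intro {isPartitionOf m xs} (∧-intro {all (1 ≤ᵇ_) xs} (Allₚ.all⁻ _ (All.map positive allowed)) (∧-intro ordered sum≡))
               (∧-intro {all A xs} (Allₚ.all⁻ A allowed) distinct)

-- Integer constants in the truncated rings

constants : ∀ N → CommutativeRing.rawRing ℤₚ.+-*-commutativeRing -Raw-AlmostCommutative⟶
                  fromCommutativeRing (truncated N)
constants N = record
  { ⟦_⟧    = ⟨_⟩
  ; +-homo = λ a b → ≐⇒≈ λ { zero → refl ; (suc n) → refl }
  ; *-homo = λ a b → ≐⇒≈ λ n → sym (trans (⟨⟩-⊛ a ⟨ b ⟩ n) (scaled a b n))
  ; -‿homo = λ a → ≐⇒≈ λ { zero → refl ; (suc n) → refl }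
  ; 0-homo = ≐⇒≈ λ { zero → refl ; (suc n) → refl }
  ; 1-homo = ≐⇒≈ λ n → refl
  }
  where
  scaled : ∀ a b n → a * ⟨ b ⟩ n ≡ ⟨ a * b ⟩ n
  scaled a b zero    = refl
  scaled a b (suc n) = ℤₚ.*-zeroʳ a

module Truncated (N : ℕ) where
  open CommutativeRing (truncated N) public
    using (*-congˡ; *-congʳ; *-cong; *-assoc; *-comm; *-identityʳ)
    renaming (sym to ≈-sym; trans to ≈-trans; reflexive to ≈-reflexive)
  open Identities (truncated N) (constants N) public

-- Weighted generating functions for the partitions of one colour

module Counting (z : ℤ) where

  partWeight : ℕ → ℤ
  partWeight x = if isEven x then - z else 1ℤ

  weight : List ℕ → ℤ
  weight []       = 1ℤ
  weight (x ∷ xs) = partWeight x * weight xs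

  weight-++ : ∀ xs ys → weight (xs ++ ys) ≡ weight xs * weight ys
  weight-++ []       ys = sym (ℤₚ.*-identityˡ (weight ys))
  weight-++ (x ∷ xs) ys =
    trans (cong (partWeight x *_) (weight-++ xs ys)) (sym (ℤₚ.*-assoc (partWeight x) (weight xs) (weight ys)))

  linear : ℕ → FPS
  linear i = ⟨ 1ℤ ⟩ ⊖ ⟨ z ⟩ ⊛ q^ i

  geometric : ℕ → FPS
  geometric i = inv (⟨ 1ℤ ⟩ ⊖ ⟨ 1ℤ ⟩ ⊛ q^ i)

  factor : ℕ → FPS
  factor i = if isEven i then linear i else geometric i

  partsGF : (ℕ → Bool) → ℕ → FPS
  partsGF A zero    = ⟨ 1ℤ ⟩
  partsGF A (suc k) = if A (suc k) then factor (suc k) ⊛ partsGF A k else partsGF A k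

  q^-1-zero : ∀ k → (⟨ 1ℤ ⟩ ⊖ ⟨ 1ℤ ⟩ ⊛ q^ (suc k)) 0 ≡ 1ℤ
  q^-1-zero k = cong (λ a → 1ℤ ℤ.- a) (⊛-zero ⟨ 1ℤ ⟩ (q^ (suc k)))

  geometric-inverse : ∀ k → (⟨ 1ℤ ⟩ ⊖ ⟨ 1ℤ ⟩ ⊛ q^ (suc k)) ⊛ geometric (suc k) ≐ ⟨ 1ℤ ⟩
  geometric-inverse k = ⊛-inverseʳ (⟨ 1ℤ ⟩ ⊖ ⟨ 1ℤ ⟩ ⊛ q^ (suc k)) (q^-1-zero k)

  linear-⊛ : ∀ i G n → (linear i ⊛ G) n ≡ G n + - z * (q^ i ⊛ G) n
  linear-⊛ i G n = begin
    ((⟨ 1ℤ ⟩ ⊖ ⟨ z ⟩ ⊛ q^ i) ⊛ G) n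
      ≡⟨ at (expand ⟨ z ⟩ (q^ i) G) n ℕₚ.≤-refl ⟩
    G n ℤ.- (⟨ z ⟩ ⊛ (q^ i ⊛ G)) n
      ≡⟨ cong (λ a → G n ℤ.- a) (⟨⟩-⊛ z (q^ i ⊛ G) n) ⟩
    G n ℤ.- z * (q^ i ⊛ G) n
      ≡⟨ cong (G n +_) (ℤₚ.neg-distribˡ-* z ((q^ i ⊛ G) n)) ⟩
    G n + - z * (q^ i ⊛ G) n ∎
    where
    open ≡-Reasoning
    expand : ∀ a b c → (⟨ 1ℤ ⟩ ⊖ a ⊛ b) ⊛ c ≈[ n ] c ⊖ a ⊛ (b ⊛ c)
    expand = Truncated.linear-expand n

  geometric-⊛ : ∀ k G n → let i = suc k ; H = geometric i ⊛ G in H n ≡ G n + (q^ i ⊛ H) n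
  geometric-⊛ k G n = at (Truncated.unit-expand n {q^ (suc k)} {geometric (suc k)} G geometric-inverse′) n ℕₚ.≤-refl
    where
    geometric-inverse′ : (⟨ 1ℤ ⟩ ⊖ ⟨ 1ℤ ⟩ ⊛ q^ (suc k)) ⊛ geometric (suc k) ≈[ n ] ⟨ 1ℤ ⟩
    geometric-inverse′ = ≐⇒≈ (geometric-inverse k)

  partWeightIn : (ℕ → Bool) → ℕ → ℤ
  partWeightIn A x = 𝟙 (A x) * partWeight x

  -- Either k + 1 does not occur, or it is the largest part and is split off. What remains is
  -- bounded by `allowedBelow`: for an even part the series up to k, from the linear factor, and for
  -- an odd part the series up to k + 1 itself, from the geometric factor. Thus both parities obey
  -- one recurrence.
  partsGF-suc : ∀ A k n → partsGF A (suc k) n ≡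
    partsGF A k n + partWeightIn A (suc k) * (q^ (suc k) ⊛ partsGF A (allowedBelow (suc k))) n
  partsGF-suc A k n with A (suc k) in allowed
  ... | false = sym (ℤₚ.+-identityʳ _)
  ... | true with isEven (suc k) in even
  ...   | true  = trans (linear-⊛ (suc k) (partsGF A k) n)
                        (cong (λ c → partsGF A k n + c * (q^ (suc k) ⊛ partsGF A k) n) (sym (ℤₚ.*-identityˡ (- z))))
  ...   | false rewrite allowed | even =
    trans (geometric-⊛ k (partsGF A k) n) (cong (partsGF A k n +_) (sym (ℤₚ.*-identityˡ _)))

  partsGF-stable : ∀ A n d → partsGF A (d ℕ.+ n) n ≡ partsGF A n n
  partsGF-stable A n zero    = refl
  partsGF-stable A n (suc d) = begin
    partsGF A (suc (d ℕ.+ n)) n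
      ≡⟨ partsGF-suc A (d ℕ.+ n) n ⟩
    partsGF A (d ℕ.+ n) n + w * (q^ (suc (d ℕ.+ n)) ⊛ partsGF A (allowedBelow (suc (d ℕ.+ n)))) n
      ≡⟨ cong₂ (λ a b → a + w * b) (partsGF-stable A n d)
               (q^-⊛-< (suc (d ℕ.+ n)) (partsGF A (allowedBelow (suc (d ℕ.+ n)))) n (s≤s (ℕₚ.m≤n+m n d))) ⟩
    partsGF A n n + w * 0ℤ
      ≡⟨ cong (partsGF A n n +_) (ℤₚ.*-zeroʳ w) ⟩
    partsGF A n n + 0ℤ
      ≡⟨ ℤₚ.+-identityʳ _ ⟩
    partsGF A n n ∎
    where
    open ≡-Reasoning
    w = partWeightIn A (suc (d ℕ.+ n))

  partsGF-≥ : ∀ A {n k} → n ≤ k → partsGF A k n ≡ partsGF A n n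
  partsGF-≥ A {n} {k} n≤k =
    trans (cong (λ j → partsGF A j n) (sym (ℕₚ.m∸n+n≡m n≤k))) (partsGF-stable A n (k ∸ n))

  listWeight : (ℕ → Bool) → ℕ → List ℕ → ℤ
  listWeight A k xs = 𝟙 (admissible A k xs) * weight xs

  listWeight-∷ : ∀ A k x xs →
    listWeight A k (x ∷ xs) ≡ 𝟙 (x ≤ᵇ k) * (partWeightIn A x * listWeight A (allowedBelow x) xs)
  listWeight-∷ A k x xs with x ≤ᵇ k | A x
  ... | true  | true  = regroup (𝟙 (admissible A (allowedBelow x) xs)) (partWeight x) (weight xs)
    where
    regroup : ∀ a b c → a * (b * c) ≡ 1ℤ * (1ℤ * b * (a * c))
    regroup = solve-∀
  ... | true  | false = refl
  ... | false | _     = refl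

  leadingPart : (ℕ → Bool) → ℕ → ℕ → ℤ
  leadingPart A m x = partWeightIn A x * (q^ x ⊛ partsGF A (allowedBelow x)) m

  module _ {A : ℕ → Bool} (A0 : A 0 ≡ false) where
    partWeightIn-0 : partWeightIn A 0 ≡ 0ℤ
    partWeightIn-0 rewrite A0 = refl

    -- This is `partsGF-suc` iterated down to 0; the isolated indicator accounts for the empty list.
    -- The sum runs to n instead of k to match `listsUpTo`, whose entries have the same range at
    -- every position.
    partsGF-leading : ∀ n m k → k ≤ n →
      𝟙 (0 ≡ᵇ m) + ∑ (upTo (suc n)) (λ x → 𝟙 (x ≤ᵇ k) * leadingPart A m x) ≡ partsGF A k m
    partsGF-leading n m zero _ = begin
      𝟙 (0 ≡ᵇ m) + ∑ (upTo (suc n)) (λ x → 𝟙 (x ≤ᵇ 0) * leadingPart A m x)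
        ≡⟨ cong (𝟙 (0 ≡ᵇ m) +_) (∑-ext (upTo (suc n)) λ x → cong (λ b → 𝟙 b * leadingPart A m x) (≤ᵇ0 x)) ⟩
      𝟙 (0 ≡ᵇ m) + ∑ (upTo (suc n)) (λ x → 𝟙 (x ≡ᵇ 0) * leadingPart A m x)
        ≡⟨ cong (𝟙 (0 ≡ᵇ m) +_) (∑-δ {suc n} (leadingPart A m) (s≤s z≤n)) ⟩
      𝟙 (0 ≡ᵇ m) + leadingPart A m 0
        ≡⟨ cong (λ w → 𝟙 (0 ≡ᵇ m) + w * (q^ 0 ⊛ partsGF A (allowedBelow 0)) m) partWeightIn-0 ⟩
      𝟙 (0 ≡ᵇ m) + 0ℤ
        ≡⟨ one m ⟩
      ⟨ 1ℤ ⟩ m ∎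
      where
      open ≡-Reasoning
      ≤ᵇ0 : ∀ x → (x ≤ᵇ 0) ≡ (x ≡ᵇ 0)
      ≤ᵇ0 zero    = refl
      ≤ᵇ0 (suc x) = refl
      one : ∀ m → 𝟙 (0 ≡ᵇ m) + 0ℤ ≡ ⟨ 1ℤ ⟩ m
      one zero    = refl
      one (suc m) = refl
    partsGF-leading n m (suc k) k<n = begin
      𝟙 (0 ≡ᵇ m) + ∑ xs (λ x → 𝟙 (x ≤ᵇ suc k) * e x)
        ≡⟨ cong (𝟙 (0 ≡ᵇ m) +_) (∑-ext xs λ x →
             trans (cong (_* e x) (𝟙-≤ᵇ-suc x k)) (ℤₚ.*-distribʳ-+ (e x) (𝟙 (x ≤ᵇ k)) (𝟙 (x ≡ᵇ suc k)))) ⟩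
      𝟙 (0 ≡ᵇ m) + ∑ xs (λ x → 𝟙 (x ≤ᵇ k) * e x + 𝟙 (x ≡ᵇ suc k) * e x)
        ≡⟨ cong (𝟙 (0 ≡ᵇ m) +_) (∑-+ xs (λ x → 𝟙 (x ≤ᵇ k) * e x) (λ x → 𝟙 (x ≡ᵇ suc k) * e x)) ⟩
      𝟙 (0 ≡ᵇ m) + (∑ xs (λ x → 𝟙 (x ≤ᵇ k) * e x) + ∑ xs (λ x → 𝟙 (x ≡ᵇ suc k) * e x))
        ≡⟨ ℤₚ.+-assoc (𝟙 (0 ≡ᵇ m)) _ _ ⟨
      𝟙 (0 ≡ᵇ m) + ∑ xs (λ x → 𝟙 (x ≤ᵇ k) * e x) + ∑ xs (λ x → 𝟙 (x ≡ᵇ suc k) * e x)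
        ≡⟨ cong₂ _+_ (partsGF-leading n m k (ℕₚ.<⇒≤ k<n)) (∑-δ {suc n} e (s≤s k<n)) ⟩
      partsGF A k m + e (suc k)
        ≡⟨ partsGF-suc A k m ⟨
      partsGF A (suc k) m ∎
      where
      open ≡-Reasoning
      xs = upTo (suc n)
      e  = leadingPart A m

    -- Parts that contribute are positive, so removing the first part x leaves a sum m - x that fits
    -- the length bound l - 1. Hence m ≤ l guarantees that the bounded enumeration misses nothing.
    listsUpTo-GF : ∀ l n m k → m ≤ l → k ≤ n →
      ∑ (listsUpTo l n) (λ xs → 𝟙 (sumℕ xs ≡ᵇ m) * listWeight A k xs) ≡ partsGF A k m
    listsUpTo-GF zero    n .0 k z≤n k≤n = sym (partsGF-≥ A {0} {k} z≤n)
    listsUpTo-GF (suc l) n m k m≤l k≤n = begin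
      𝟙 (0 ≡ᵇ m) * 1ℤ + ∑ (concatMap extend (upTo (suc n))) v
        ≡⟨ cong₂ _+_ (ℤₚ.*-identityʳ (𝟙 (0 ≡ᵇ m))) (∑-concatMap extend (upTo (suc n)) v) ⟩
      𝟙 (0 ≡ᵇ m) + ∑ (upTo (suc n)) (λ x → ∑ (extend x) v)
        ≡⟨ cong (𝟙 (0 ≡ᵇ m) +_) (∑-upTo-cong (suc n) λ x x<1+n →
             trans (∑-map (x ∷_) (listsUpTo l n) v) (leading x (ℕₚ.≤-pred x<1+n))) ⟩
      𝟙 (0 ≡ᵇ m) + ∑ (upTo (suc n)) (λ x → 𝟙 (x ≤ᵇ k) * leadingPart A m x)
        ≡⟨ partsGF-leading n m k k≤n ⟩
      partsGF A k m ∎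
      where
      open ≡-Reasoning
      extend : ℕ → List (List ℕ)
      extend x = map (x ∷_) (listsUpTo l n)
      v : List ℕ → ℤ
      v xs = 𝟙 (sumℕ xs ≡ᵇ m) * listWeight A k xs

      regroup : ∀ a b c d → a * (b * (c * d)) ≡ b * c * (a * d)
      regroup = solve-∀

      factored : ∀ x → ∑ (listsUpTo l n) (λ xs → v (x ∷ xs)) ≡
        𝟙 (x ≤ᵇ k) * partWeightIn A x *
        ∑ (listsUpTo l n) (λ xs → 𝟙 (x ℕ.+ sumℕ xs ≡ᵇ m) * listWeight A (allowedBelow x) xs)
      factored x = trans
        (∑-ext (listsUpTo l n) λ xs → trans (cong (𝟙 (x ℕ.+ sumℕ xs ≡ᵇ m) *_) (listWeight-∷ A k x xs))
          (regroup (𝟙 (x ℕ.+ sumℕ xs ≡ᵇ m)) (𝟙 (x ≤ᵇ k)) (partWeightIn A x) _))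
        (∑-*ˡ (listsUpTo l n) (𝟙 (x ≤ᵇ k) * partWeightIn A x) _)

      rest : ∀ x → 1 ≤ x → x ≤ n →
        ∑ (listsUpTo l n) (λ xs → 𝟙 (x ℕ.+ sumℕ xs ≡ᵇ m) * listWeight A (allowedBelow x) xs) ≡
        (q^ x ⊛ partsGF A (allowedBelow x)) m
      rest x 1≤x x≤n with x ℕₚ.≤? m
      ... | no x≰m = trans
        (trans (∑-ext (listsUpTo l n) λ xs → cong (λ b → 𝟙 b * listWeight A (allowedBelow x) xs) (tooLarge xs))
               (∑-0 (listsUpTo l n)))
        (sym (q^-⊛-< x (partsGF A (allowedBelow x)) m (ℕₚ.≰⇒> x≰m)))
        where
        tooLarge : ∀ xs → (x ℕ.+ sumℕ xs ≡ᵇ m) ≡ false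
        tooLarge xs = T-ext {b = false}
          (λ h → x≰m (subst (x ≤_) (ℕₚ.≡ᵇ⇒≡ (x ℕ.+ sumℕ xs) m h) (ℕₚ.m≤m+n x (sumℕ xs)))) (λ ())
      ... | yes x≤m = begin
        ∑ (listsUpTo l n) (λ xs → 𝟙 (x ℕ.+ sumℕ xs ≡ᵇ m) * listWeight A (allowedBelow x) xs)
          ≡⟨ ∑-ext (listsUpTo l n) (λ xs → cong (λ b → 𝟙 b * listWeight A (allowedBelow x) xs)
               (trans (cong (x ℕ.+ sumℕ xs ≡ᵇ_) (sym m≡)) (≡ᵇ-cancelˡ x (sumℕ xs) (m ∸ x)))) ⟩
        ∑ (listsUpTo l n) (λ xs → 𝟙 (sumℕ xs ≡ᵇ m ∸ x) * listWeight A (allowedBelow x) xs)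
          ≡⟨ listsUpTo-GF l n (m ∸ x) (allowedBelow x) m∸x≤l (ℕₚ.≤-trans (allowedBelow-≤ x) x≤n) ⟩
        partsGF A (allowedBelow x) (m ∸ x)
          ≡⟨ q^-⊛-shift x (partsGF A (allowedBelow x)) (m ∸ x) ⟨
        (q^ x ⊛ partsGF A (allowedBelow x)) (x ℕ.+ (m ∸ x))
          ≡⟨ cong (q^ x ⊛ partsGF A (allowedBelow x)) m≡ ⟩
        (q^ x ⊛ partsGF A (allowedBelow x)) m ∎
        where
        m≡ : x ℕ.+ (m ∸ x) ≡ m
        m≡ = ℕₚ.m+[n∸m]≡n x≤m
        m∸x≤l : m ∸ x ≤ l
        m∸x≤l = ℕₚ.≤-trans (ℕₚ.∸-monoʳ-≤ m 1≤x) (ℕₚ.∸-monoˡ-≤ 1 m≤l)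

      leading : ∀ x → x ≤ n → ∑ (listsUpTo l n) (λ xs → v (x ∷ xs)) ≡ 𝟙 (x ≤ᵇ k) * leadingPart A m x
      leading zero    x≤n = begin
        ∑ (listsUpTo l n) (λ xs → v (0 ∷ xs))      ≡⟨ factored 0 ⟩
        𝟙 (0 ≤ᵇ k) * partWeightIn A 0 * S           ≡⟨ cong (λ w → 𝟙 (0 ≤ᵇ k) * w * S) partWeightIn-0 ⟩
        0ℤ                                          ≡⟨ cong (λ w → 𝟙 (0 ≤ᵇ k) * (w * (q^ 0 ⊛ partsGF A (allowedBelow 0)) m)) partWeightIn-0 ⟨
        𝟙 (0 ≤ᵇ k) * leadingPart A m 0              ∎
        where S = ∑ (listsUpTo l n) (λ xs → 𝟙 (sumℕ xs ≡ᵇ m) * listWeight A (allowedBelow 0) xs)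
      leading (suc x) x≤n = trans (factored (suc x))
        (trans (cong (𝟙 (suc x ≤ᵇ k) * partWeightIn A (suc x) *_) (rest (suc x) (s≤s z≤n) x≤n))
               (ℤₚ.*-assoc (𝟙 (suc x ≤ᵇ k)) (partWeightIn A (suc x)) _))

    partitionsOf-GF : ∀ m →
      ∑ (partitionsOf m) (λ xs → 𝟙 (all A xs ∧ evenPartsDistinct xs) * weight xs) ≡ partsGF A m m
    partitionsOf-GF m = begin
      ∑ (partitionsOf m) (λ xs → 𝟙 (all A xs ∧ evenPartsDistinct xs) * weight xs)
        ≡⟨ ∑-filterᵇ (isPartitionOf m) (listsUpTo m m) _ ⟩
      ∑ (listsUpTo m m) (λ xs → 𝟙 (isPartitionOf m xs) * (𝟙 (all A xs ∧ evenPartsDistinct xs) * weight xs))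
        ≡⟨ ∑-ext (listsUpTo m m) (λ xs → trans
             (regroup (isPartitionOf m xs) (all A xs ∧ evenPartsDistinct xs) (weight xs))
             (trans (cong (λ b → 𝟙 b * weight xs) (partition⇔admissible A0 m xs))
                    (sym (regroup (sumℕ xs ≡ᵇ m) (admissible A m xs) (weight xs))))) ⟩
      ∑ (listsUpTo m m) (λ xs → 𝟙 (sumℕ xs ≡ᵇ m) * listWeight A m xs)
        ≡⟨ listsUpTo-GF m m m m ℕₚ.≤-refl ℕₚ.≤-refl ⟩
      partsGF A m m ∎
      where
      open ≡-Reasoning
      regroup : ∀ a b c → 𝟙 a * (𝟙 b * c) ≡ 𝟙 (a ∧ b) * c
      regroup a b c = trans (sym (ℤₚ.*-assoc (𝟙 a) (𝟙 b) c)) (cong (_* c) (sym (𝟙-∧ a b)))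

-- Two-colour partitions classified by their smallest part

leastPart : ℕ → ℕ
leastPart j = 1 ℕ.+ 2 ℕ.* j

leastPart-suc : ∀ j → leastPart (suc j) ≡ 2 ℕ.+ leastPart j
leastPart-suc j = cong (λ n → suc (suc n)) (ℕₚ.+-suc j (j ℕ.+ 0))

isEven-suc : ∀ n → isEven (suc n) ≡ not (isEven n)
isEven-suc zero          = refl
isEven-suc (suc zero)    = refl
isEven-suc (suc (suc n)) = isEven-suc n

isEven-leastPart : ∀ j → isEven (leastPart j) ≡ false
isEven-leastPart zero    = refl
isEven-leastPart (suc j) = trans (cong isEven (leastPart-suc j)) (isEven-leastPart j)

isOdd⇒leastPart : ∀ n → T (isOdd n) → ∃ λ j → n ≡ leastPart j
isOdd⇒leastPart (suc zero)    _ = 0 , refl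
isOdd⇒leastPart (suc (suc n)) h =
  let j , n≡ = isOdd⇒leastPart n h
  in suc j , trans (cong (2 ℕ.+_) n≡) (sym (leastPart-suc j))

leastPart-injective : ∀ {i j} → leastPart i ≡ leastPart j → i ≡ j
leastPart-injective {i} {j} eq = ℕₚ.*-cancelˡ-≡ i j 2 (ℕₚ.suc-injective eq)

blueAllowed greenAllowed : ℕ → ℕ → Bool
blueAllowed  j x = (leastPart j ≤ᵇ x) ∧ (not (isEven x) ∨ (5 ℕ.+ leastPart j ≤ᵇ x))
greenAllowed j x = leastPart j ≤ᵇ x

without : (ℕ → Bool) → ℕ → ℕ → Bool
without A s x = A x ∧ not (s ≡ᵇ x)

selects : (ℕ → Bool) → ℕ → List ℕ → Bool
selects A s xs = elemᵇ s xs ∧ (all A xs ∧ evenPartsDistinct xs)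

all-without : ∀ A s xs → all (without A s) xs ≡ all A xs ∧ not (elemᵇ s xs)
all-without A s []       = refl
all-without A s (x ∷ xs) with A x | s ≡ᵇ x
... | false | _     = refl
... | true  | false = all-without A s xs
... | true  | true  = sym (∧-false (all A xs))
  where
  ∧-false : ∀ b → b ∧ false ≡ false
  ∧-false true  = refl
  ∧-false false = refl

-- Occurrence of s is counted by complement: the two conditions on the right only restrict the set
-- of allowed parts, so each of them has a product as its generating function.
𝟙-selects : ∀ A s xs → 𝟙 (selects A s xs) ≡
  𝟙 (all A xs ∧ evenPartsDistinct xs) + - 𝟙 (all (without A s) xs ∧ evenPartsDistinct xs)
𝟙-selects A s xs rewrite all-without A s xs with elemᵇ s xs | all A xs | evenPartsDistinct xs
... | true  | true  | true  = refl
... | true  | true  | false = refl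
... | true  | false | _     = refl
... | false | true  | true  = refl
... | false | true  | false = refl
... | false | false | _     = refl

elemᵇ-All : ∀ {P : ℕ → Set} {s} xs → T (elemᵇ s xs) → All P xs → P s
elemᵇ-All {s = s} (x ∷ xs) h (px ∷ pxs) with s ≡ᵇ x in eq
... | true  = subst _ (sym (ℕₚ.≡ᵇ⇒≡ s x (subst T (sym eq) tt))) px
... | false = elemᵇ-All xs h pxs

foldr-⊓-≤ : ∀ b xs → foldr _⊓_ b xs ≤ b × All (foldr _⊓_ b xs ≤_) xs
foldr-⊓-≤ b []       = ℕₚ.≤-refl , []
foldr-⊓-≤ b (x ∷ xs) =
  let m = foldr _⊓_ b xs
      m≤b , m≤xs = foldr-⊓-≤ b xs
  in ℕₚ.≤-trans (ℕₚ.m⊓n≤n x m) m≤b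
   , (ℕₚ.m⊓n≤m x m ∷ All.map (ℕₚ.≤-trans (ℕₚ.m⊓n≤n x m)) m≤xs)

≤-foldr-⊓ : ∀ {s b} xs → s ≤ b → All (s ≤_) xs → s ≤ foldr _⊓_ b xs
≤-foldr-⊓ []       s≤b []           = s≤b
≤-foldr-⊓ (x ∷ xs) s≤b (s≤x ∷ s≤xs) = ℕₚ.⊓-glb s≤x (≤-foldr-⊓ xs s≤b s≤xs)

blueAllowed⁻ : ∀ {j x} → T (blueAllowed j x) → leastPart j ≤ x
blueAllowed⁻ {j} {x} h = ℕₚ.≤ᵇ⇒≤ (leastPart j) x (proj₁ (∧-elim {leastPart j ≤ᵇ x} h))

≤ᵇ-swap : ∀ s x → (suc (s ℕ.+ 5) ≤ᵇ suc x) ≡ (5 ℕ.+ s ≤ᵇ x)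
≤ᵇ-swap s x = T-ext
  (λ h → ℕₚ.≤⇒≤ᵇ (subst (_≤ x) (ℕₚ.+-comm s 5) (ℕₚ.≤-pred (ℕₚ.≤ᵇ⇒≤ _ (suc x) h))))
  (λ h → ℕₚ.≤⇒≤ᵇ (s≤s (subst (_≤ x) (ℕₚ.+-comm 5 s) (ℕₚ.≤ᵇ⇒≤ (5 ℕ.+ s) x h))))

-- The condition of `condC` with the minimum replaced by a variable, so that it can be transported
-- along an equality between the minimum and `leastPart j`.
condFor : ℕ → List ℕ → List ℕ → Bool
condFor s blue green =
  isOdd s ∧ elemᵇ s blue ∧ elemᵇ s green
  ∧ all (λ p → not (isEven p) ∨ (suc (s ℕ.+ 5) ≤ᵇ suc p)) blue
  ∧ evenPartsDistinct blue ∧ evenPartsDistinct green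

selects⇒condC : ∀ j bs gs → T (selects (blueAllowed j) (leastPart j) bs) →
                T (selects (greenAllowed j) (leastPart j) gs) → T (condC (bs , gs))
selects⇒condC j (b ∷ bs) (g ∷ gs) h k =
  subst (λ s → T (condFor s (b ∷ bs) (g ∷ gs))) s≡min
    (∧-intro {isOdd s} odd (∧-intro {elemᵇ s (b ∷ bs)} s∈b (∧-intro {elemᵇ s (g ∷ gs)} s∈g
      (∧-intro (Allₚ.all⁻ _ (All.map (λ {p} → far {p}) allowedᵇ))
               (∧-intro {evenPartsDistinct (b ∷ bs)} distinctᵇ distinctᵍ)))))
  where
  s = leastPart j
  odd : T (isOdd s)
  odd rewrite isEven-leastPart j = tt
  hs = ∧-elim {elemᵇ s (b ∷ bs)} h
  ks = ∧-elim {elemᵇ s (g ∷ gs)} k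
  s∈b = proj₁ hs
  s∈g = proj₁ ks
  distinctᵇ = proj₂ (∧-elim {all (blueAllowed j) (b ∷ bs)} (proj₂ hs))
  distinctᵍ = proj₂ (∧-elim {all (greenAllowed j) (g ∷ gs)} (proj₂ ks))
  allowedᵇ : All (T ∘ blueAllowed j) (b ∷ bs)
  allowedᵇ = Allₚ.all⁺ _ (b ∷ bs) (proj₁ (∧-elim {all (blueAllowed j) (b ∷ bs)} (proj₂ hs)))
  s≤g : All (s ≤_) (g ∷ gs)
  s≤g = All.map (λ {x} → ℕₚ.≤ᵇ⇒≤ s x) (Allₚ.all⁺ _ (g ∷ gs) (proj₁ (∧-elim {all (greenAllowed j) (g ∷ gs)} (proj₂ ks))))
  far : ∀ {p} → T (blueAllowed j p) → T (not (isEven p) ∨ (suc (s ℕ.+ 5) ≤ᵇ suc p))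
  far {p} a rewrite ≤ᵇ-swap s p = proj₂ (∧-elim {s ≤ᵇ p} a)
  s≤b : All (s ≤_) (b ∷ bs)
  s≤b = All.map (λ {x} → blueAllowed⁻ {j} {x}) allowedᵇ
  min≤ = foldr-⊓-≤ b (bs ++ g ∷ gs)
  s≡min : s ≡ foldr _⊓_ b (bs ++ g ∷ gs)
  s≡min = ℕₚ.≤-antisym
    (≤-foldr-⊓ (bs ++ g ∷ gs) (All.head s≤b) (Allₚ.++⁺ (All.tail s≤b) s≤g))
    (elemᵇ-All (b ∷ bs) s∈b (proj₁ min≤ ∷ Allₚ.++⁻ˡ bs (proj₂ min≤)))

condC⇒selects : ∀ bs gs → T (condC (bs , gs)) →
  ∃ λ j → T (selects (blueAllowed j) (leastPart j) bs) × T (selects (greenAllowed j) (leastPart j) gs)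
condC⇒selects (b ∷ bs) (g ∷ gs) h = j
  , ∧-intro {elemᵇ s (b ∷ bs)} s∈b (∧-intro {all (blueAllowed j) (b ∷ bs)}
      (Allₚ.all⁻ _ (All.zipWith (λ {p} (s≤p , f) → near {p} s≤p f) (s≤b , Allₚ.all⁺ _ (b ∷ bs) farᵇ))) distinctᵇ)
  , ∧-intro {elemᵇ s (g ∷ gs)} s∈g (∧-intro {all (greenAllowed j) (g ∷ gs)}
      (Allₚ.all⁻ _ (All.map ℕₚ.≤⇒≤ᵇ s≤g)) distinctᵍ)
  where
  min = foldr _⊓_ b (bs ++ g ∷ gs)
  form = isOdd⇒leastPart min (proj₁ (∧-elim {isOdd min} h))
  j = proj₁ form
  s = leastPart j
  h₀ : T (condFor s (b ∷ bs) (g ∷ gs))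
  h₀ = subst (λ s → T (condFor s (b ∷ bs) (g ∷ gs))) (proj₂ form) h
  h₁ = ∧-elim {elemᵇ s (b ∷ bs)} (proj₂ (∧-elim {isOdd s} h₀))
  s∈b = proj₁ h₁
  h₂ = ∧-elim {elemᵇ s (g ∷ gs)} (proj₂ h₁)
  s∈g = proj₁ h₂
  h₃ = ∧-elim {all (λ p → not (isEven p) ∨ (suc (s ℕ.+ 5) ≤ᵇ suc p)) (b ∷ bs)} (proj₂ h₂)
  farᵇ = proj₁ h₃
  h₄ = ∧-elim {evenPartsDistinct (b ∷ bs)} (proj₂ h₃)
  distinctᵇ = proj₁ h₄
  distinctᵍ = proj₂ h₄
  min≤ : min ≤ b × All (min ≤_) (bs ++ g ∷ gs)
  min≤ = foldr-⊓-≤ b (bs ++ g ∷ gs)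
  s≤ : ∀ {x} → min ≤ x → s ≤ x
  s≤ {x} = subst (_≤ x) (proj₂ form)
  s≤b : All (s ≤_) (b ∷ bs)
  s≤b = All.map s≤ (proj₁ min≤ ∷ Allₚ.++⁻ˡ bs (proj₂ min≤))
  s≤g : All (s ≤_) (g ∷ gs)
  s≤g = All.map s≤ (Allₚ.++⁻ʳ bs (proj₂ min≤))
  near : ∀ {p} → s ≤ p → T (not (isEven p) ∨ (suc (s ℕ.+ 5) ≤ᵇ suc p)) → T (blueAllowed j p)
  near {p} s≤p f rewrite ≤ᵇ-swap s p = ∧-intro (ℕₚ.≤⇒≤ᵇ s≤p) f

-- Each of the two least parts occurs in the list and is a lower bound for it, so each is at most
-- the other.
selects-unique : ∀ {i j} bs → T (selects (blueAllowed i) (leastPart i) bs) →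
                 T (selects (blueAllowed j) (leastPart j) bs) → i ≡ j
selects-unique {i} {j} bs h k = leastPart-injective (ℕₚ.≤-antisym (half i j h k) (half j i k h))
  where
  half : ∀ i j → T (selects (blueAllowed i) (leastPart i) bs) →
         T (selects (blueAllowed j) (leastPart j) bs) → leastPart i ≤ leastPart j
  half i j h k =
    let _ , rest = ∧-elim {elemᵇ (leastPart i) bs} h
        allowed , _ = ∧-elim {all (blueAllowed i) bs} rest
        s∈b , _ = ∧-elim {elemᵇ (leastPart j) bs} k
    in blueAllowed⁻ {i} {leastPart j} (elemᵇ-All {P = T ∘ blueAllowed i} {leastPart j} bs s∈b (Allₚ.all⁺ _ bs allowed))

selects-bound : ∀ A j xs → T (selects A (leastPart j) xs) → j < suc (sumℕ xs)
selects-bound A j xs h =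
  s≤s (ℕₚ.≤-trans (ℕₚ.≤-trans (ℕₚ.m≤m+n j (j ℕ.+ 0)) (ℕₚ.n≤1+n _))
                  (elemᵇ-All xs (proj₁ (∧-elim {elemᵇ (leastPart j) xs} h)) (≤-sumℕ xs)))

-- The sum has at most one nonzero term, the j whose `leastPart` is the smallest part. This j is
-- below J because `leastPart j` is one of the blue parts and hence at most their sum.
𝟙-condC : ∀ J bs gs → sumℕ bs < J →
  𝟙 (condC (bs , gs)) ≡ ∑ (upTo J) (λ j → 𝟙 (selects (blueAllowed j) (leastPart j) bs) *
                                           𝟙 (selects (greenAllowed j) (leastPart j) gs))
𝟙-condC J bs gs sum<J with condC (bs , gs) in eq
... | false = sym (trans (∑-ext (upTo J) λ j → trans (sym (𝟙-∧ (blue j) (green j))) (cong 𝟙 (none j))) (∑-0 (upTo J)))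
  where
  blue green : ℕ → Bool
  blue  j = selects (blueAllowed j) (leastPart j) bs
  green j = selects (greenAllowed j) (leastPart j) gs
  none : ∀ j → blue j ∧ green j ≡ false
  none j = T-ext {b = false}
    (λ h → subst T eq (selects⇒condC j bs gs (proj₁ (∧-elim {blue j} h)) (proj₂ (∧-elim {blue j} h)))) (λ ())
... | true =
  let j₀ , b , g = condC⇒selects bs gs (subst T (sym eq) tt)
      single : ∀ j → blue j ∧ green j ≡ (j ≡ᵇ j₀)
      single j = T-ext
        (λ h → ℕₚ.≡⇒≡ᵇ j j₀ (selects-unique bs (proj₁ (∧-elim {blue j} h)) b))
        (λ h → subst (λ j → T (blue j ∧ green j)) (sym (ℕₚ.≡ᵇ⇒≡ j j₀ h)) (∧-intro {blue j₀} b g))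
  in sym (trans
       (∑-ext (upTo J) λ j → trans (sym (𝟙-∧ (blue j) (green j)))
                                   (trans (cong 𝟙 (single j)) (sym (ℤₚ.*-identityʳ (𝟙 (j ≡ᵇ j₀))))))
       (∑-δ {J} (λ _ → 1ℤ) (ℕₚ.≤-trans (selects-bound (blueAllowed j₀) j₀ bs b) sum<J)))
  where
  blue green : ℕ → Bool
  blue  j = selects (blueAllowed j) (leastPart j) bs
  green j = selects (greenAllowed j) (leastPart j) gs

module Totals (z : ℤ) where
  open Counting z

  selected : (ℕ → Bool) → ℕ → FPS
  selected A s m = ∑ (partitionsOf m) (λ xs → 𝟙 (selects A s xs) * weight xs)

  selected-GF : ∀ {A} → A 0 ≡ false → ∀ s m →
    selected A s m ≡ partsGF A m m + - partsGF (without A s) m m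
  selected-GF {A} A0 s m = begin
    ∑ ps (λ xs → 𝟙 (selects A s xs) * weight xs)
      ≡⟨ ∑-ext ps (λ xs → trans (cong (_* weight xs) (𝟙-selects A s xs))
                                (split (good A xs) (good (without A s) xs) (weight xs))) ⟩
    ∑ ps (λ xs → good A xs * weight xs + - (good (without A s) xs * weight xs))
      ≡⟨ ∑-+ ps _ _ ⟩
    ∑ ps (λ xs → good A xs * weight xs) + ∑ ps (λ xs → - (good (without A s) xs * weight xs))
      ≡⟨ cong (∑ ps (λ xs → good A xs * weight xs) +_) (∑-neg ps _) ⟩
    ∑ ps (λ xs → good A xs * weight xs) + - ∑ ps (λ xs → good (without A s) xs * weight xs)
      ≡⟨ cong₂ (λ a b → a + - b) (partitionsOf-GF A0 m) (partitionsOf-GF without-0 m) ⟩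
    partsGF A m m + - partsGF (without A s) m m ∎
    where
    open ≡-Reasoning
    ps = partitionsOf m
    good : (ℕ → Bool) → List ℕ → ℤ
    good A xs = 𝟙 (all A xs ∧ evenPartsDistinct xs)
    split : ∀ a b c → (a + - b) * c ≡ a * c + - (b * c)
    split = solve-∀
    without-0 : without A s 0 ≡ false
    without-0 rewrite A0 = refl

  blue green : ℕ → FPS
  blue  j = selected (blueAllowed j) (leastPart j)
  green j = selected (greenAllowed j) (leastPart j)

  total : FPS
  total n = ∑ (twoColourPartitionsOf n) (λ π → 𝟙 (condC π) * weight (proj₁ π ++ proj₂ π))

  -- Once the smallest part is fixed, the condition on the pair splits into one on the blue parts
  -- and one on the green parts. The sum over pairs then factors, and summing over the size of the
  -- blue half gives a Cauchy product.
  total-≡ : ∀ {J} n → n < J → total n ≡ ∑ (upTo J) (λ j → (blue j ⊛ green j) n)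
  total-≡ {J} n n<J = begin
    total n
      ≡⟨ ∑-concatMap (λ m → cartesianProduct (partitionsOf m) (partitionsOf (n ∸ m))) (upTo (suc n)) _ ⟩
    ∑ (upTo (suc n)) (λ m → ∑ (cartesianProduct (partitionsOf m) (partitionsOf (n ∸ m)))
                              (λ π → 𝟙 (condC π) * weight (proj₁ π ++ proj₂ π)))
      ≡⟨ ∑-upTo-cong (suc n) (λ m m<1+n → trans
           (∑-cartesianProduct (partitionsOf m) (partitionsOf (n ∸ m)) _)
           (separate m (ℕₚ.≤-pred m<1+n))) ⟩
    ∑ (upTo (suc n)) (λ m → ∑ (upTo J) (λ j → blue j m * green j (n ∸ m)))
      ≡⟨ ∑-swap (upTo (suc n)) (upTo J) _ ⟩
    ∑ (upTo J) (λ j → ∑ (upTo (suc n)) (λ m → blue j m * green j (n ∸ m)))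
      ≡⟨ ∑-ext (upTo J) (λ j → sym (⊛-coefficient (blue j) (green j) n)) ⟩
    ∑ (upTo J) (λ j → (blue j ⊛ green j) n) ∎
    where
    open ≡-Reasoning
    wᵇ wᵍ : ℕ → List ℕ → ℤ
    wᵇ j b = 𝟙 (selects (blueAllowed j) (leastPart j) b) * weight b
    wᵍ j g = 𝟙 (selects (greenAllowed j) (leastPart j) g) * weight g

    regroup : ∀ a b c d → a * b * (c * d) ≡ a * c * (b * d)
    regroup = solve-∀

    pointwise : ∀ b g → sumℕ b < J → 𝟙 (condC (b , g)) * weight (b ++ g) ≡ ∑ (upTo J) (λ j → wᵇ j b * wᵍ j g)
    pointwise b g sum<J = trans
      (cong₂ _*_ (𝟙-condC J b g sum<J) (weight-++ b g))
      (trans (sym (∑-*ʳ (upTo J) (weight b * weight g) _))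
             (∑-ext (upTo J) λ j → regroup (𝟙 (selects (blueAllowed j) (leastPart j) b)) _ (weight b) (weight g)))

    sum-of-partition : ∀ m b → T (isPartitionOf m b) → sumℕ b ≡ m
    sum-of-partition m b h = ℕₚ.≡ᵇ⇒≡ (sumℕ b) m
      (proj₂ (∧-elim {nonIncreasing b} (proj₂ (∧-elim {all (1 ≤ᵇ_) b} h))))

    separate : ∀ m → m ≤ n →
      ∑ (partitionsOf m) (λ b → ∑ (partitionsOf (n ∸ m)) (λ g → 𝟙 (condC (b , g)) * weight (b ++ g))) ≡
      ∑ (upTo J) (λ j → blue j m * green j (n ∸ m))
    separate m m≤n = begin
      ∑ bs (λ b → ∑ gs (λ g → 𝟙 (condC (b , g)) * weight (b ++ g)))
        ≡⟨ ∑-filterᵇ-cong (isPartitionOf m) (listsUpTo m m) (λ b h → trans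
             (∑-ext gs λ g → pointwise b g
               (subst (_< J) (sym (sum-of-partition m b h)) (ℕₚ.≤-<-trans m≤n n<J)))
             (trans (∑-swap gs (upTo J) _) (∑-ext (upTo J) λ j → ∑-*ˡ gs (wᵇ j b) (wᵍ j)))) ⟩
      ∑ bs (λ b → ∑ (upTo J) (λ j → wᵇ j b * green j (n ∸ m)))
        ≡⟨ ∑-swap bs (upTo J) _ ⟩
      ∑ (upTo J) (λ j → ∑ bs (λ b → wᵇ j b * green j (n ∸ m)))
        ≡⟨ ∑-ext (upTo J) (λ j → ∑-*ʳ bs (green j (n ∸ m)) (wᵇ j)) ⟩
      ∑ (upTo J) (λ j → blue j m * green j (n ∸ m)) ∎
      where
      bs = partitionsOf m
      gs = partitionsOf (n ∸ m)

module _ where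
  open Totals

  genC-total : genC ≐ total -1ℤ
  -- The only two-colour partition of 0 is the pair of empty lists, which `condC` rejects.
  genC-total zero    = refl
  genC-total (suc n) = trans (length-filterᵇ condC ps)
    (∑-ext ps λ π → trans (sym (ℤₚ.*-identityʳ (𝟙 (condC π))))
                          (cong (𝟙 (condC π) *_) (sym (weight-1 (proj₁ π ++ proj₂ π)))))
    where
    ps = twoColourPartitionsOf (suc n)
    weight-1 : ∀ xs → Counting.weight -1ℤ xs ≡ 1ℤ
    weight-1 []       = refl
    weight-1 (x ∷ xs) with isEven x
    ... | true  = trans (ℤₚ.*-identityˡ _) (weight-1 xs)
    ... | false = trans (ℤₚ.*-identityˡ _) (weight-1 xs)

  -- At z = 1 every even part has weight -1, so the weight of a partition is the sign with which it
  -- enters C₀ - C₁.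
  genC′-total : genC′ ≐ total 1ℤ
  genC′-total zero    = refl
  genC′-total (suc n) = begin
    pos (C₀ (suc n)) + - pos (C₁ (suc n))
      ≡⟨ cong₂ (λ a b → a + - b) (length-filterᵇ evenly ps) (length-filterᵇ oddly ps) ⟩
    ∑ ps (𝟙 ∘ evenly) + - ∑ ps (𝟙 ∘ oddly)
      ≡⟨ cong (∑ ps (𝟙 ∘ evenly) +_) (∑-neg ps (𝟙 ∘ oddly)) ⟨
    ∑ ps (𝟙 ∘ evenly) + ∑ ps (λ π → - 𝟙 (oddly π))
      ≡⟨ ∑-+ ps (𝟙 ∘ evenly) _ ⟨
    ∑ ps (λ π → 𝟙 (evenly π) + - 𝟙 (oddly π))
      ≡⟨ ∑-ext ps (λ π → trans (signed (condC π) (isEven (numEvenParts π)))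
                               (cong (𝟙 (condC π) *_) (sym (weight-sign (proj₁ π ++ proj₂ π))))) ⟩
    total 1ℤ (suc n) ∎
    where
    open ≡-Reasoning
    ps = twoColourPartitionsOf (suc n)
    evenly oddly : List ℕ × List ℕ → Bool
    evenly π = condC π ∧ isEven (numEvenParts π)
    oddly  π = condC π ∧ isOdd (numEvenParts π)
    sign : Bool → ℤ
    sign b = if b then 1ℤ else -1ℤ
    signed : ∀ a b → 𝟙 (a ∧ b) + - 𝟙 (a ∧ not b) ≡ 𝟙 a * sign b
    signed false b     = refl
    signed true  true  = refl
    signed true  false = refl
    sign-not : ∀ b → -1ℤ * sign b ≡ sign (not b)
    sign-not true  = refl
    sign-not false = refl
    weight-sign : ∀ xs → Counting.weight 1ℤ xs ≡ sign (isEven (length (filterᵇ isEven xs)))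
    weight-sign []       = refl
    weight-sign (x ∷ xs) with isEven x
    ... | false = trans (ℤₚ.*-identityˡ _) (weight-sign xs)
    ... | true  = trans (cong (-1ℤ *_) (weight-sign xs))
      (trans (sign-not (isEven (length (filterᵇ isEven xs))))
             (cong sign (sym (isEven-suc (length (filterᵇ isEven xs))))))

-- Infinite products and sums modulo q^(N+1)

prodTo : ℕ → (ℕ → FPS) → FPS
prodTo zero    f = ⟨ 1ℤ ⟩
prodTo (suc k) f = prodTo k f ⊛ f k

prodL-prodTo : ∀ N k f → prodL (map f (upTo k)) ≈[ N ] prodTo k f
prodL-prodTo N zero    f = ≐⇒≈ λ _ → refl
prodL-prodTo N (suc k) f = ≈-trans
  (≈-reflexive (cong (prodL ∘ map f) (sym (Listₚ.upTo-∷ʳ k))))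
  (≈-trans (snoc (upTo k)) (*-congʳ {f k} (prodL-prodTo N k f)))
  where
  open Truncated N
  prodL-∷ : ∀ x fs → prodL (x ∷ fs) ≈[ N ] x ⊛ prodL fs
  prodL-∷ x fs = ≈-reflexive (sym (⊛-Defs x (prodL fs)))
  snoc : ∀ xs → prodL (map f (xs ++ k ∷ [])) ≈[ N ] prodL (map f xs) ⊛ f k
  snoc []       = ≈-trans (prodL-∷ (f k) []) (*-comm (f k) ⟨ 1ℤ ⟩)
  snoc (x ∷ xs) = ≈-trans (prodL-∷ (f x) (map f (xs ++ k ∷ [])))
    (≈-trans (*-congˡ {f x} (snoc xs))
    (≈-trans (≈-sym (*-assoc (f x) (prodL (map f xs)) (f k)))
             (*-congʳ {f k} (≈-sym (prodL-∷ (f x) (map f xs))))))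

prodTo-cong : ∀ {f g} k → (∀ j → f j ≡ g j) → prodTo k f ≡ prodTo k g
prodTo-cong zero    f≡g = refl
prodTo-cong (suc k) f≡g = cong₂ _⊛_ (prodTo-cong k f≡g) (f≡g k)

prodTo-stable : ∀ f → (∀ j n → n ≤ j → f j ≈[ n ] ⟨ 1ℤ ⟩) → ∀ {n k} → n < k → prodTo k f n ≡ prodTo (suc n) f n
prodTo-stable f f≈1 {n} {suc k} (s≤s n≤k) with n ℕₚ.≟ k
... | yes refl = refl
... | no n≢k = begin
  (prodTo k f ⊛ f k) n
    ≡⟨ at (*-congˡ {prodTo k f} (f≈1 k n n≤k)) n ℕₚ.≤-refl ⟩
  (prodTo k f ⊛ ⟨ 1ℤ ⟩) n
    ≡⟨ at (*-identityʳ (prodTo k f)) n ℕₚ.≤-refl ⟩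
  prodTo k f n
    ≡⟨ prodTo-stable f f≈1 (ℕₚ.≤∧≢⇒< n≤k n≢k) ⟩
  prodTo (suc n) f n ∎
  where
  open ≡-Reasoning
  open Truncated n

prod∞-prodTo : ∀ {N k} f → (∀ j n → n ≤ j → f j ≈[ n ] ⟨ 1ℤ ⟩) → N < k → prod∞ f ≈[ N ] prodTo k f
prod∞-prodTo f f≈1 N<k = mod λ n n≤N →
  trans (at (prodL-prodTo n (suc n) f) n ℕₚ.≤-refl) (sym (prodTo-stable f f≈1 (ℕₚ.≤-<-trans n≤N N<k)))

pochFactor : ℤ → ℕ → ℕ → FPS
pochFactor a c j = ⟨ 1ℤ ⟩ ⊖ ⟨ a ⟩ ⊛ q^ (c ℕ.+ 2 ℕ.* j)

pochFactor-≈1 : ∀ {c} a → 1 ≤ c → ∀ j n → n ≤ j → pochFactor a c j ≈[ n ] ⟨ 1ℤ ⟩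
pochFactor-≈1 {c} a 1≤c j n n≤j = mod λ i i≤n → trans
  (cong (λ b → ⟨ 1ℤ ⟩ i + - b)
    (trans (⟨⟩-⊛ a (q^ (c ℕ.+ 2 ℕ.* j)) i)
           (trans (cong (a *_) (at (q^-vanish large) i i≤n)) (ℤₚ.*-zeroʳ a))))
  (ℤₚ.+-identityʳ (⟨ 1ℤ ⟩ i))
  where
  large : n < c ℕ.+ 2 ℕ.* j
  large = ℕₚ.≤-trans (s≤s n≤j) (ℕₚ.+-mono-≤ 1≤c (ℕₚ.m≤m+n j (j ℕ.+ 0)))

poch-prodTo : ∀ {N k} a c → 1 ≤ c → N < k → poch a c 2 ≈[ N ] prodTo k (pochFactor a c)
poch-prodTo {N} {k} a c 1≤c N<k = subst (poch a c 2 ≈[ N ]_) (prodTo-cong k (sym ∘ pochFactor≡))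
  (prod∞-prodTo _ (λ j n n≤j → subst (_≈[ n ] ⟨ 1ℤ ⟩) (pochFactor≡ j) (pochFactor-≈1 a 1≤c j n n≤j)) N<k)
  where
  pochFactor≡ : ∀ j → pochFactor a c j ≡ ⟨ 1ℤ ⟩ ⊖ ⟨ a ⟩ Defs.⊛ q^ (c ℕ.+ 2 ℕ.* j)
  pochFactor≡ j = cong (⟨ 1ℤ ⟩ ⊖_) (⊛-Defs ⟨ a ⟩ (q^ (c ℕ.+ 2 ℕ.* j)))

sum-sumTo : ∀ N J (t : ℕ → FPS) → (λ n → ∑ (upTo J) (λ j → t j n)) ≈[ N ] Truncated.sumTo N J t
sum-sumTo N zero    t = ≐⇒≈ λ _ → refl
sum-sumTo N (suc J) t = mod λ n n≤N →
  trans (∑-last J (λ j → t j n)) (cong (_+ t J n) (at (sum-sumTo N J t) n n≤N))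

sum∞-sumTo : ∀ {N J} (t : ℕ → FPS) → (∀ j n → n < j → t j n ≡ 0ℤ) → N < J → sum∞ t ≈[ N ] Truncated.sumTo N J t
sum∞-sumTo {N} {J} t t≈0 N<J = mod λ n n≤N →
  trans (sym (stable (ℕₚ.≤-<-trans n≤N N<J))) (at (sum-sumTo N J t) n n≤N)
  where
  stable : ∀ {n J} → n < J → ∑ (upTo J) (λ j → t j n) ≡ sum∞ t n
  stable {n} {suc J} (s≤s n≤J) with n ℕₚ.≟ J
  ... | yes refl = refl
  ... | no n≢J   =
    trans (∑-last J (λ j → t j n))
          (trans (cong (∑ (upTo J) (λ j → t j n) +_) (t≈0 J n n<J))
                 (trans (ℤₚ.+-identityʳ _) (stable n<J)))
    where n<J = ℕₚ.≤∧≢⇒< n≤J n≢J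

-- How the sets of allowed parts change with the smallest part

-- Defined by recursion so that `twice (suc k)` unfolds to two successors, as `isEven` and `partsGF`
-- need in order to compute; `2 * k` does not.
twice : ℕ → ℕ
twice zero    = zero
twice (suc k) = suc (suc (twice k))

twice≡2* : ∀ k → twice k ≡ 2 ℕ.* k
twice≡2* zero    = refl
twice≡2* (suc k) = trans (cong (2 ℕ.+_) (twice≡2* k)) (sym (ℕₚ.*-suc 2 k))

isEven-twice : ∀ k → isEven (twice k) ≡ true
isEven-twice zero    = refl
isEven-twice (suc k) = isEven-twice k

not-≡ᵇ : ∀ {x s} → x ≢ s → T (not (s ≡ᵇ x))
not-≡ᵇ {x} {s} x≢s with s ≡ᵇ x in eq
... | true  = x≢s (sym (ℕₚ.≡ᵇ⇒≡ s x (subst T (sym eq) tt)))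
... | false = tt

not-≡ᵇ⁻ : ∀ {x s} → T (not (s ≡ᵇ x)) → x ≢ s
not-≡ᵇ⁻ {x} h refl rewrite Equivalence.to T-≡ (≡ᵇ-refl x) = h

evenImplies : ∀ {x a} → T (not (isEven x) ∨ (a ≤ᵇ x)) → T (isEven x) → a ≤ x
evenImplies {x} {a} h e with isEven x
... | true = ℕₚ.≤ᵇ⇒≤ a x h

impliedByEven : ∀ {x a} → (T (isEven x) → a ≤ x) → T (not (isEven x) ∨ (a ≤ᵇ x))
impliedByEven {x} h with isEven x
... | true  = ℕₚ.≤⇒≤ᵇ (h tt)
... | false = tt

blueAllowed-least : ∀ j → blueAllowed j (leastPart j) ≡ true
blueAllowed-least j rewrite Equivalence.to T-≡ (ℕₚ.≤⇒≤ᵇ (ℕₚ.≤-refl {leastPart j})) | isEven-leastPart j = refl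

greenAllowed-least : ∀ j → greenAllowed j (leastPart j) ≡ true
greenAllowed-least j = Equivalence.to T-≡ (ℕₚ.≤⇒≤ᵇ (ℕₚ.≤-refl {leastPart j}))

blueAllowed-far : ∀ j → without (blueAllowed j) (leastPart j) (5 ℕ.+ leastPart j) ≡ true
blueAllowed-far j = Equivalence.to T-≡ (∧-intro {blueAllowed j (5 ℕ.+ s)}
  (∧-intro {s ≤ᵇ 5 ℕ.+ s} (ℕₚ.≤⇒≤ᵇ (ℕₚ.m≤n+m s 5)) (impliedByEven {5 ℕ.+ s} λ _ → ℕₚ.≤-refl))
  (not-≡ᵇ {5 ℕ.+ s} {s} (ℕₚ.>⇒≢ (ℕₚ.m≤n+m (suc s) 4))))
  where s = leastPart j

greenAllowed-next : ∀ j → without (greenAllowed j) (leastPart j) (1 ℕ.+ leastPart j) ≡ true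
greenAllowed-next j = Equivalence.to T-≡ (∧-intro {greenAllowed j (1 ℕ.+ s)}
  (ℕₚ.≤⇒≤ᵇ (ℕₚ.n≤1+n s)) (not-≡ᵇ {1 ℕ.+ s} {s} (ℕₚ.>⇒≢ (ℕₚ.n<1+n s))))
  where s = leastPart j

-- With s odd, replacing s by s + 2 raises the odd bound past s alone and the even bound s + 5 past
-- that value alone: s + 1 and s + 3 were already forbidden, and s + 6 is odd.
blueAllowed-suc : ∀ j x →
  without (without (blueAllowed j) (leastPart j)) (5 ℕ.+ leastPart j) x ≡ blueAllowed (suc j) x
blueAllowed-suc j x =
  trans (T-ext to from) (cong (λ s → (s ≤ᵇ x) ∧ (not (isEven x) ∨ (5 ℕ.+ s ≤ᵇ x))) (sym (leastPart-suc j)))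
  where
  s = leastPart j
  even-suc-s : isEven (suc s) ≡ true
  even-suc-s = trans (isEven-suc s) (cong not (isEven-leastPart j))
  to : T (without (without (blueAllowed j) s) (5 ℕ.+ s) x) →
       T ((2 ℕ.+ s ≤ᵇ x) ∧ (not (isEven x) ∨ (7 ℕ.+ s ≤ᵇ x)))
  to h = ∧-intro {2 ℕ.+ s ≤ᵇ x} (ℕₚ.≤⇒≤ᵇ 2+s≤x) (impliedByEven {x} λ e →
    -- An even x is at least s + 5; it is not s + 5, which was removed, and not s + 6, which is odd.
    ℕₚ.≤∧≢⇒< (ℕₚ.≤∧≢⇒< (far e) (not-≡ᵇ⁻ x≢5+s ∘ sym))
             (λ { refl → subst T (isEven-leastPart j) e }))
    where
    h₁ = proj₁ (∧-elim {without (blueAllowed j) s x} h)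
    x≢5+s = proj₂ (∧-elim {without (blueAllowed j) s x} h)
    h₂ = proj₁ (∧-elim {blueAllowed j x} h₁)
    x≢s = proj₂ (∧-elim {blueAllowed j x} h₁)
    far : T (isEven x) → 5 ℕ.+ s ≤ x
    far = evenImplies {x} (proj₂ (∧-elim {s ≤ᵇ x} h₂))
    s<x : s < x
    s<x = ℕₚ.≤∧≢⇒< (ℕₚ.≤ᵇ⇒≤ s x (proj₁ (∧-elim {s ≤ᵇ x} h₂))) (not-≡ᵇ⁻ x≢s ∘ sym)
    2+s≤x : 2 ℕ.+ s ≤ x
    -- The value s + 1 is excluded because it is even and lies below s + 5.
    2+s≤x = ℕₚ.≤∧≢⇒< s<x λ { refl → ℕₚ.<⇒≱ (s≤s (s≤s (ℕₚ.m≤n+m s 3))) (far (subst T (sym even-suc-s) tt)) }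
  from : T ((2 ℕ.+ s ≤ᵇ x) ∧ (not (isEven x) ∨ (7 ℕ.+ s ≤ᵇ x))) →
         T (without (without (blueAllowed j) s) (5 ℕ.+ s) x)
  from h = ∧-intro {without (blueAllowed j) s x}
    (∧-intro {blueAllowed j x}
      (∧-intro {s ≤ᵇ x} (ℕₚ.≤⇒≤ᵇ (ℕₚ.<⇒≤ s<x)) (impliedByEven {x} λ e → ℕₚ.≤-trans (ℕₚ.m≤n+m _ 2) (far e)))
      (not-≡ᵇ {x} {s} (ℕₚ.>⇒≢ s<x)))
    (not-≡ᵇ {x} {5 ℕ.+ s} λ { refl → ℕₚ.<⇒≱ (ℕₚ.n≤1+n _) (far (subst T (sym even-suc-s) tt)) })
    where
    s<x : s < x
    s<x = ℕₚ.≤-trans (ℕₚ.n≤1+n (suc s)) (ℕₚ.≤ᵇ⇒≤ (2 ℕ.+ s) x (proj₁ (∧-elim {2 ℕ.+ s ≤ᵇ x} h)))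
    far : T (isEven x) → 7 ℕ.+ s ≤ x
    far = evenImplies {x} (proj₂ (∧-elim {2 ℕ.+ s ≤ᵇ x} h))

greenAllowed-suc : ∀ j x →
  without (without (greenAllowed j) (leastPart j)) (1 ℕ.+ leastPart j) x ≡ greenAllowed (suc j) x
greenAllowed-suc j x = trans (T-ext to from) (cong (_≤ᵇ x) (sym (leastPart-suc j)))
  where
  s = leastPart j
  to : T (without (without (greenAllowed j) s) (1 ℕ.+ s) x) → T (2 ℕ.+ s ≤ᵇ x)
  to h =
    let h₁ , x≢1+s = ∧-elim {without (greenAllowed j) s x} h
        s≤x , x≢s = ∧-elim {greenAllowed j x} h₁
    in ℕₚ.≤⇒≤ᵇ (ℕₚ.≤∧≢⇒< (ℕₚ.≤∧≢⇒< (ℕₚ.≤ᵇ⇒≤ s x s≤x) (not-≡ᵇ⁻ x≢s ∘ sym)) (not-≡ᵇ⁻ x≢1+s ∘ sym))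
  from : T (2 ℕ.+ s ≤ᵇ x) → T (without (without (greenAllowed j) s) (1 ℕ.+ s) x)
  from h =
    let 2+s≤x = ℕₚ.≤ᵇ⇒≤ (2 ℕ.+ s) x h
        s<x = ℕₚ.≤-trans (ℕₚ.n≤1+n (suc s)) 2+s≤x
    in ∧-intro {without (greenAllowed j) s x}
         (∧-intro {greenAllowed j x} (ℕₚ.≤⇒≤ᵇ (ℕₚ.<⇒≤ s<x)) (not-≡ᵇ {x} {s} (ℕₚ.>⇒≢ s<x)))
         (not-≡ᵇ {x} {1 ℕ.+ s} (ℕₚ.>⇒≢ 2+s≤x))

-- The blue parts for s = 1 together with 4, so that their even parts are counted by poch _ 4 2.
wideAllowed : ℕ → Bool
wideAllowed x = (1 ≤ᵇ x) ∧ (not (isEven x) ∨ (4 ≤ᵇ x))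

wideAllowed-4 : ∀ x → without wideAllowed 4 x ≡ blueAllowed 0 x
wideAllowed-4 0 = refl
wideAllowed-4 1 = refl
wideAllowed-4 2 = refl
wideAllowed-4 3 = refl
wideAllowed-4 4 = refl
wideAllowed-4 5 = refl
wideAllowed-4 (suc (suc (suc (suc (suc (suc x)))))) with isEven x
... | true  = refl
... | false = refl

-- Product formulas and the functional equation modulo q^(N+1)

module Products (z : ℤ) (N : ℕ) where
  open Counting z
  open Truncated N

  partsGF-cong : ∀ {A B} k → (∀ x → 1 ≤ x → x ≤ k → A x ≡ B x) → partsGF A k ≡ partsGF B k
  partsGF-cong zero    h = refl
  partsGF-cong (suc k) h
    rewrite h (suc k) (s≤s z≤n) ℕₚ.≤-refl | partsGF-cong k (λ x 1≤x x≤k → h x 1≤x (ℕₚ.m≤n⇒m≤1+n x≤k)) = refl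

  partsGF-remove : ∀ {A B} i → A i ≡ true → B i ≡ false → (∀ x → x ≢ i → A x ≡ B x) →
                   ∀ k → 1 ≤ i → i ≤ k → partsGF A k ≈[ N ] factor i ⊛ partsGF B k
  partsGF-remove i Ai Bi h zero    1≤i i≤0 = ⊥-elim (ℕₚ.<⇒≱ 1≤i i≤0)
  partsGF-remove {A} {B} i Ai Bi h (suc k) 1≤i i≤1+k with i ℕₚ.≟ suc k
  ... | yes refl rewrite Ai | Bi =
    ≈-reflexive (cong (factor (suc k) ⊛_) (partsGF-cong k λ x _ x≤k → h x (ℕₚ.<⇒≢ (s≤s x≤k))))
  ... | no i≢ rewrite h (suc k) (i≢ ∘ sym) with B (suc k)
  ...   | false = partsGF-remove i Ai Bi h k 1≤i (ℕₚ.≤-pred (ℕₚ.≤∧≢⇒< i≤1+k i≢))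
  ...   | true  = ≈-trans
    (*-congˡ {factor (suc k)} (partsGF-remove i Ai Bi h k 1≤i (ℕₚ.≤-pred (ℕₚ.≤∧≢⇒< i≤1+k i≢))))
    (exchange (factor (suc k)) (factor i) (partsGF B k))

  partsGF-allowed : ∀ {A k} → A (suc k) ≡ true → partsGF A (suc k) ≡ factor (suc k) ⊛ partsGF A k
  partsGF-allowed allowed rewrite allowed = refl

  factor-even : ∀ {i} → isEven i ≡ true → factor i ≡ linear i
  factor-even even rewrite even = refl

  factor-odd : ∀ {i} → isEven i ≡ false → factor i ≡ geometric i
  factor-odd odd rewrite odd = refl

  oddFactor : ℕ → FPS
  oddFactor j = pochFactor 1ℤ 1 j

  -- The Pochhammer products advance in steps of two, so parts are added in pairs 2k + 1, 2k + 2.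
  -- Multiplying by the odd factor cancels the geometric series of 2k + 1, and only the linear
  -- factor of 2k + 2 survives.
  partsGF-pair : ∀ {A} k → A (suc (twice k)) ≡ true → A (twice (suc k)) ≡ true →
    oddFactor k ⊛ partsGF A (twice (suc k)) ≈[ N ] pochFactor z 2 k ⊛ partsGF A (twice k)
  partsGF-pair {A} k A-odd A-even = ≈-trans
    (*-congˡ {oddFactor k} (≈-reflexive unfolded))
    (cancel-pair (oddFactor k) (pochFactor z 2 k) (geometric (1 ℕ.+ 2 ℕ.* k)) (partsGF A (twice k))
                 (≐⇒≈ (geometric-inverse (2 ℕ.* k))))
    where
    odd-suc-twice : isEven (suc (twice k)) ≡ false
    odd-suc-twice = trans (isEven-suc (twice k)) (cong not (isEven-twice k))
    unfolded : partsGF A (twice (suc k)) ≡ pochFactor z 2 k ⊛ (geometric (1 ℕ.+ 2 ℕ.* k) ⊛ partsGF A (twice k))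
    unfolded = trans (partsGF-allowed {A} {suc (twice k)} A-even) (cong₂ _⊛_
      (trans (factor-even {twice (suc k)} (isEven-twice (suc k))) (cong (λ n → linear (2 ℕ.+ n)) (twice≡2* k)))
      (trans (partsGF-allowed {A} {twice k} A-odd) (cong (_⊛ partsGF A (twice k))
        (trans (factor-odd {suc (twice k)} odd-suc-twice) (cong (λ n → geometric (suc n)) (twice≡2* k))))))

  partsGF-without : ∀ {A} i k → A i ≡ true → 1 ≤ i → i ≤ k →
                    partsGF A k ≈[ N ] factor i ⊛ partsGF (without A i) k
  partsGF-without {A} i k Ai = partsGF-remove i Ai removed other k
    where
    removed : without A i i ≡ false
    removed rewrite Ai | Equivalence.to T-≡ (≡ᵇ-refl i) = refl
    other : ∀ x → x ≢ i → A x ≡ without A i x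
    other x x≢i = T-ext
      (λ h → ∧-intro h (not-≡ᵇ x≢i))
      (λ h → proj₁ (∧-elim {A x} h))

  partsGF-vanish : ∀ {A} k → N ≤ k → (∀ x → x ≤ N → A x ≡ false) → partsGF A k ≈[ N ] ⟨ 1ℤ ⟩
  partsGF-vanish {A} k N≤k h = mod λ n n≤N → trans
    (partsGF-≥ A (ℕₚ.≤-trans n≤N N≤k))
    (cong (λ f → f n) (trans (partsGF-cong n (λ x _ x≤n → h x (ℕₚ.≤-trans x≤n n≤N))) (none n)))
    where
    none : ∀ n → partsGF (λ _ → false) n ≡ ⟨ 1ℤ ⟩
    none zero    = refl
    none (suc n) = none n

  open Totals z

  -- One copy of the odd part s is split off and the rest may still contain s, hence the same series
  -- reappears with the factor q^s. The bound k is harmless, as parts beyond N do not affect the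
  -- coefficients up to N.
  selected-≈ : ∀ {A} j k → N ≤ k → A 0 ≡ false → A (leastPart j) ≡ true → leastPart j ≤ k →
               selected A (leastPart j) ≈[ N ] q^ (leastPart j) ⊛ partsGF A k
  selected-≈ {A} j k N≤k A0 As s≤k = ≈-trans
    (mod λ n n≤N → trans (selected-GF A0 s n)
      (cong₂ (λ a b → a + - b) (sym (partsGF-≥ A (ℕₚ.≤-trans n≤N N≤k)))
                               (sym (partsGF-≥ (without A s) (ℕₚ.≤-trans n≤N N≤k)))))
    (split-difference {q^ s} {geometric s} {partsGF A k} {partsGF (without A s) k}
      (≐⇒≈ (geometric-inverse (2 ℕ.* j)))
      (subst (λ v → partsGF A k ≈[ N ] v ⊛ partsGF (without A s) k) (factor-odd {leastPart j} (isEven-leastPart j))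
             (partsGF-without {A} s k As (s≤s z≤n) s≤k)))
    where s = leastPart j

  blue-step : ∀ j k → 6 ℕ.+ 2 ℕ.* j ≤ k → partsGF (blueAllowed j) k ≈[ N ]
    geometric (leastPart j) ⊛ (linear (6 ℕ.+ 2 ℕ.* j) ⊛ partsGF (blueAllowed (suc j)) k)
  blue-step j k 5+s≤k = ≈-trans
    (subst (λ v → partsGF (blueAllowed j) k ≈[ N ] v ⊛ partsGF (without (blueAllowed j) s) k)
           (factor-odd {leastPart j} (isEven-leastPart j))
           (partsGF-without {blueAllowed j} s k (blueAllowed-least j) (s≤s z≤n) (ℕₚ.≤-trans (ℕₚ.m≤n+m s 5) 5+s≤k)))
    (*-congˡ {geometric s}
      (subst₂ (λ v F → partsGF (without (blueAllowed j) s) k ≈[ N ] v ⊛ F)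
              (factor-even {5 ℕ.+ s} (trans (isEven-suc (leastPart j)) (cong not (isEven-leastPart j))))
              (partsGF-cong {A = without (without (blueAllowed j) s) (5 ℕ.+ s)} {blueAllowed (suc j)} k λ x _ _ → blueAllowed-suc j x)
              (partsGF-without {without (blueAllowed j) s} (5 ℕ.+ s) k (blueAllowed-far j) (s≤s z≤n) 5+s≤k)))
    where s = leastPart j

  green-step : ∀ j k → 2 ℕ.+ 2 ℕ.* j ≤ k → partsGF (greenAllowed j) k ≈[ N ]
    geometric (leastPart j) ⊛ (linear (2 ℕ.+ 2 ℕ.* j) ⊛ partsGF (greenAllowed (suc j)) k)
  green-step j k 1+s≤k = ≈-trans
    (subst (λ v → partsGF (greenAllowed j) k ≈[ N ] v ⊛ partsGF (without (greenAllowed j) s) k)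
           (factor-odd {leastPart j} (isEven-leastPart j))
           (partsGF-without {greenAllowed j} s k (greenAllowed-least j) (s≤s z≤n) (ℕₚ.≤-trans (ℕₚ.n≤1+n s) 1+s≤k)))
    (*-congˡ {geometric s}
      (subst₂ (λ v F → partsGF (without (greenAllowed j) s) k ≈[ N ] v ⊛ F)
              (factor-even {1 ℕ.+ s} (trans (isEven-suc (leastPart j)) (cong not (isEven-leastPart j))))
              (partsGF-cong {A = without (without (greenAllowed j) s) (1 ℕ.+ s)} {greenAllowed (suc j)} k λ x _ _ → greenAllowed-suc j x)
              (partsGF-without {without (greenAllowed j) s} (1 ℕ.+ s) k (greenAllowed-next j) (s≤s z≤n) 1+s≤k)))
    where s = leastPart j

  green-start : ∀ k → prodTo k oddFactor ⊛ partsGF (greenAllowed 0) (twice k) ≈[ N ] prodTo k (pochFactor z 2)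
  green-start zero    = *-identityʳ ⟨ 1ℤ ⟩
  green-start (suc k) = extend-product
    {prodTo k oddFactor} {oddFactor k} {partsGF (greenAllowed 0) (twice (suc k))}
    {pochFactor z 2 k} {partsGF (greenAllowed 0) (twice k)} {prodTo k (pochFactor z 2)}
    (partsGF-pair {greenAllowed 0} k refl refl) (green-start k)

  -- The products have different lengths since the part 2 is missing: up to 2k + 2 there are k + 1
  -- odd parts, but only the k even parts 4, ..., 2k + 2.
  wide-start : ∀ k → prodTo (suc k) oddFactor ⊛ partsGF wideAllowed (twice (suc k)) ≈[ N ] prodTo k (pochFactor z 4)
  wide-start zero    = unit-pair {oddFactor 0} {geometric 1} (≐⇒≈ (geometric-inverse 0))
  wide-start (suc k) = subst (λ e → prodTo (2 ℕ.+ k) oddFactor ⊛ partsGF wideAllowed (twice (2 ℕ.+ k)) ≈[ N ]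
                                     prodTo k (pochFactor z 4) ⊛ (⟨ 1ℤ ⟩ ⊖ ⟨ z ⟩ ⊛ q^ (2 ℕ.+ e)))
    (ℕₚ.*-suc 2 k)
    (extend-product
      {prodTo (suc k) oddFactor} {oddFactor (suc k)} {partsGF wideAllowed (twice (2 ℕ.+ k))}
      {pochFactor z 2 (suc k)} {partsGF wideAllowed (twice (suc k))} {prodTo k (pochFactor z 4)}
      (partsGF-pair {wideAllowed} (suc k) odd (even k)) (wide-start k))
    where
    odd : wideAllowed (suc (twice (suc k))) ≡ true
    odd rewrite isEven-suc (twice k) | isEven-twice k = refl
    even : ∀ k → wideAllowed (twice (2 ℕ.+ k)) ≡ true
    even k rewrite isEven-twice k = refl

  -- `linear 4` is the factor left over by the certificate at x = q. It adds the part 4 to the blue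
  -- ones, which gives the wide set; k ≥ 1 ensures that 4 lies within the bound 2k + 2.
  blue-start : ∀ k → 1 ≤ k →
    prodTo (suc k) oddFactor ⊛ (linear 4 ⊛ partsGF (blueAllowed 0) (twice (suc k))) ≈[ N ] prodTo k (pochFactor z 4)
  blue-start (suc k) _ = ≈-trans
    (*-congˡ {prodTo (2 ℕ.+ k) oddFactor} (≈-sym (subst (λ F → partsGF wideAllowed K ≈[ N ] linear 4 ⊛ F)
      (partsGF-cong {without wideAllowed 4} {blueAllowed 0} K λ x _ _ → wideAllowed-4 x)
      (partsGF-without {wideAllowed} 4 K refl (s≤s z≤n) (s≤s (s≤s (s≤s (s≤s z≤n))))))))
    (wide-start (suc k))
    where K = twice (2 ℕ.+ k)

  -- J = N + 1 terms suffice, because q^(2J) vanishes and `leastPart J` exceeds N. The bound K = 2N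
  -- + 8 on the parts is even, so that parts pair up, and it covers the even parts 6 + 2j removed
  -- for j ≤ N. Both k and k + 1 exceed N, so products of these lengths agree with the infinite
  -- ones.
  J k K : ℕ
  J = suc N
  k = 3 ℕ.+ N
  K = twice (suc k)

  N≤K : N ≤ K
  N≤K = ℕₚ.≤-trans (ℕₚ.≤-trans (ℕₚ.m≤n+m N 4) (ℕₚ.m≤m+n (suc k) _)) (ℕₚ.≤-reflexive (sym (twice≡2* (suc k))))

  least≤K : ∀ j → j < J → 6 ℕ.+ 2 ℕ.* j ≤ K
  least≤K j j<J = ℕₚ.≤-trans
    (ℕₚ.≤-trans (ℕₚ.+-monoʳ-≤ 6 (ℕₚ.*-monoʳ-≤ 2 (ℕₚ.≤-pred j<J))) (ℕₚ.m≤n+m _ 2))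
    (ℕₚ.≤-reflexive (trans (sym (ℕₚ.*-distribˡ-+ 2 4 N)) (sym (twice≡2* (suc k)))))

  N<leastPart-J : N < leastPart J
  N<leastPart-J = s≤s (ℕₚ.≤-trans (ℕₚ.n≤1+n N) (ℕₚ.m≤m+n (suc N) _))

  total-≈ : total ≈[ N ] sumTo J (λ j → q^ (leastPart j) ⊛ partsGF (blueAllowed j) K ⊛
                                        (q^ (leastPart j) ⊛ partsGF (greenAllowed j) K))
  total-≈ = ≈-trans (mod λ n n≤N → total-≡ n (s≤s n≤N)) (≈-trans (sum-sumTo N J (λ j → blue j ⊛ green j))
    (sumTo-cong J λ j j<J →
      let s≤K = ℕₚ.≤-trans (ℕₚ.m≤n+m (leastPart j) 5) (least≤K j j<J)
      in *-cong (selected-≈ {blueAllowed j} j K N≤K refl (blueAllowed-least j) s≤K)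
                (selected-≈ {greenAllowed j} j K N≤K refl (greenAllowed-least j) s≤K)))

  open Powers q^ (≐⇒≈ q^-0) (λ m n → ≐⇒≈ (q^-+ m n)) public

  P₀ : FPS
  P₀ = partsGF (blueAllowed 0) K ⊛ partsGF (greenAllowed 0) K

  total-certificate : Sign z → denominator (q^ 1) z ⊛ total ≈[ N ]
    (λ n → - certificate (q^ 1) z ⟨ 1ℤ ⟩ P₀ n) ⊕ numerator (q^ 1) z
  total-certificate sign = ≈-trans
    (*-congˡ {denominator (q^ 1) z} total-≈)
    (sum-certificate sign J (λ j → geometric (leastPart j))
      (λ j → partsGF (blueAllowed j) K) (λ j → partsGF (greenAllowed j) K)
      (λ j _ → ≐⇒≈ (geometric-inverse (2 ℕ.* j)))
      (λ j j<J → blue-step j K (least≤K j j<J))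
      (λ j j<J → green-step j K (ℕₚ.≤-trans (ℕₚ.m≤n+m _ 4) (least≤K j j<J)))
      vanish
      (partsGF-vanish {blueAllowed J} K N≤K λ x x≤N → cong (_∧ (not (isEven x) ∨ (5 ℕ.+ leastPart J ≤ᵇ x))) (below x x≤N))
      (partsGF-vanish {greenAllowed J} K N≤K below))
    where
    below : ∀ x → x ≤ N → (leastPart J ≤ᵇ x) ≡ false
    below x x≤N = T-ext {b = false}
      (λ h → ℕₚ.<⇒≱ (ℕₚ.≤-<-trans x≤N N<leastPart-J) (ℕₚ.≤ᵇ⇒≤ (leastPart J) x h)) (λ ())
    vanish : q^ (2 ℕ.* J) ≈[ N ] ⟨ 0ℤ ⟩
    vanish = mod λ n n≤N → trans (at (q^-vanish {N} {2 ℕ.* J} (ℕₚ.m≤m+n J (J ℕ.+ 0))) n n≤N) (sym (⟨0⟩ n))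
      where
      ⟨0⟩ : ∀ n → ⟨ 0ℤ ⟩ n ≡ 0ℤ
      ⟨0⟩ zero    = refl
      ⟨0⟩ (suc _) = refl

-- Assembling the four identities

oddProduct evenProduct₂ evenProduct₄ oddProduct² denB correctionA : FPS
oddProduct   = poch 1ℤ 1 2
evenProduct₂ = poch -1ℤ 2 2
evenProduct₄ = poch -1ℤ 4 2
oddProduct²  = oddProduct Defs.⊛ oddProduct
denB         = (⟨ 1ℤ ⟩ ⊖ q^ 1) Defs.⊛ (⟨ 1ℤ ⟩ ⊖ q^ 3) Defs.⊛ (⟨ 1ℤ ⟩ ⊖ q^ 3)
correctionA  = q^ 2 Defs.⊛ (⟨ 1ℤ ⟩ ⊖ q^ 1) Defs.⊛ inv denA

seriesTermA seriesTermB : ℕ → FPS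
seriesTermA n = ⟨ signℤ n * pos (suc n) ⟩ ⊛ (⟨ pos n ⟩ ⊖ ⟨ pos n ⟩ ⊛ q^ 1 ⊕ ⟨ pos (suc n) ⟩ ⊛ q^ 2) ⊛ q^ (3 ℕ.* n)
seriesTermB n = ⟨ pos (suc n) ⟩ ⊛ (⟨ pos n ⟩ ⊕ ⟨ pos n ⟩ ⊛ q^ 1 ⊕ ⟨ pos (suc n) ⟩ ⊛ q^ 2) ⊛ q^ (3 ℕ.* n)

opaque
  unfolding _⊛_

  -- The equations of this block identify the closed forms, written with the transparent product,
  -- with the same expressions in the opaque product of the truncated rings.
  denA-≡ : denA ≡ (⟨ 1ℤ ⟩ ⊕ q^ 1) ⊛ (⟨ 1ℤ ⟩ ⊕ q^ 3) ⊛ (⟨ 1ℤ ⟩ ⊕ q^ 3)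
  denA-≡ = refl

  denB-≡ : denB ≡ (⟨ 1ℤ ⟩ ⊖ q^ 1) ⊛ (⟨ 1ℤ ⟩ ⊖ q^ 3) ⊛ (⟨ 1ℤ ⟩ ⊖ q^ 3)
  denB-≡ = refl

  termA-≡ : termA ≡ ⟨ pos 2 ⟩ ⊛ q^ 3 ⊛ (⟨ pos 2 ⟩ ⊖ q^ 1 ⊕ q^ 2) ⊛ inv denA ⊛
                    (evenProduct₂ ⊛ evenProduct₄) ⊛ inv oddProduct²
  termA-≡ = refl

  correctionA-≡ : correctionA ≡ q^ 2 ⊛ (⟨ 1ℤ ⟩ ⊖ q^ 1) ⊛ inv denA
  correctionA-≡ = refl

  rhsB₁-≡ : rhsB₁ ≡ q^ 2 ⊛ (⟨ 1ℤ ⟩ ⊕ q^ 1) ⊛ inv denB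
  rhsB₁-≡ = refl

  seriesA-≡ : seriesA ≡ sum∞ seriesTermA
  seriesA-≡ = refl

  rhsB₂-≡ : rhsB₂ ≡ sum∞ seriesTermB
  rhsB₂-≡ = refl

⊛-q^-vanish : ∀ f j n → n < j → (f ⊛ q^ (3 ℕ.* j)) n ≡ 0ℤ
⊛-q^-vanish f j n n<j = trans (⊛-comm f (q^ (3 ℕ.* j)) n)
  (q^-⊛-< (3 ℕ.* j) f n (ℕₚ.≤-trans n<j (ℕₚ.m≤m+n j _)))

signℤ-suc : ∀ j → signℤ (suc j) ≡ -1ℤ * signℤ j
signℤ-suc j rewrite isEven-suc j with isEven j
... | true  = refl
... | false = refl

inverse-≈ : ∀ {N f g} → f ≡ g → f 0 ≡ 1ℤ → g ⊛ inv f ≈[ N ] ⟨ 1ℤ ⟩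
inverse-≈ {f = f} refl f0 = ≐⇒≈ (⊛-inverseʳ f f0)

genC-product : ∀ N → genC ≈[ N ] rhsA₁
genC-product N = subst₂ (λ a b → genC ≈[ N ] a ⊕ b) (sym termA-≡) (sym correctionA-≡) (≈-trans (≐⇒≈ genC-total)
  (value-minus {inv denA} {total} {P₀} {evenProduct₂ ⊛ evenProduct₄} {inv oddProduct²}
    (inverse-≈ denA-≡ refl) (total-certificate minus)
    (product-start {oddProduct} {inv oddProduct²} {linear 4} {partsGF (blueAllowed 0) K}
      {partsGF (greenAllowed 0) K} {evenProduct₂} {evenProduct₄}
      (inverse-≈ (sym (⊛-Defs oddProduct oddProduct)) refl)
      (≈-trans (*-congʳ {linear 4 ⊛ partsGF (blueAllowed 0) K} O≈)
        (≈-trans (blue-start k (s≤s z≤n)) (≈-sym (poch-prodTo -1ℤ 4 (s≤s z≤n) (ℕₚ.m≤n+m (suc N) 2)))))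
      (≈-trans (*-congʳ {partsGF (greenAllowed 0) K} O≈)
        (≈-trans (green-start (suc k)) (≈-sym (poch-prodTo -1ℤ 2 (s≤s z≤n) N<1+k)))))))
  where
  open Counting -1ℤ
  open Totals -1ℤ
  open Truncated N
  open Products -1ℤ N
  N<1+k : N < suc k
  N<1+k = ℕₚ.m≤n+m (suc N) 3
  O≈ : oddProduct ≈[ N ] prodTo (suc k) oddFactor
  O≈ = poch-prodTo 1ℤ 1 (s≤s z≤n) N<1+k

genC′-rational : ∀ N → genC′ ≈[ N ] rhsB₁
genC′-rational N = subst (genC′ ≈[ N ]_) (sym rhsB₁-≡) (≈-trans (≐⇒≈ genC′-total)
  (value-plus {inv denB} {total} {P₀} (inverse-≈ denB-≡ refl) (total-certificate plus)))
  where
  open Totals 1ℤ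
  open Truncated N
  open Products 1ℤ N

expansionA : ∀ N → correctionA ≈[ N ] seriesA
expansionA N = subst₂ _≈[ N ]_ (sym correctionA-≡) (sym seriesA-≡) (≈-trans
  (series-minus {inv denA} J signℤ refl signℤ-suc (inverse-≈ denA-≡ refl)
                (q^-vanish {N} {3 ℕ.* J} (ℕₚ.m≤m+n J _)))
  (≈-sym (sum∞-sumTo seriesTermA (λ j n n<j → ⊛-q^-vanish _ j n n<j) (ℕₚ.n<1+n N))))
  where
  open Truncated N
  open Products -1ℤ N

expansionB : ∀ N → rhsB₁ ≈[ N ] rhsB₂
expansionB N = subst₂ _≈[ N ]_ (sym rhsB₁-≡) (sym rhsB₂-≡) (≈-trans
  (series-plus {inv denB} J (inverse-≈ denB-≡ refl) (q^-vanish {N} {3 ℕ.* J} (ℕₚ.m≤m+n J _)))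
  (≈-sym (sum∞-sumTo seriesTermB (λ j n n<j → ⊛-q^-vanish _ j n n<j) (ℕₚ.n<1+n N))))
  where
  open Truncated N
  open Products 1ℤ N

theorem7 : ((genC ≐ rhsA₁) × (rhsA₁ ≐ rhsA₂)) × ((genC′ ≐ rhsB₁) × (rhsB₁ ≐ rhsB₂))
theorem7 = (≈⇒≐ genC-product , λ n → cong (termA n +_) (≈⇒≐ expansionA n))
         , (≈⇒≐ genC′-rational , ≈⇒≐ expansionB)
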